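{- Let $N$ be a (not necessarily abelian) group of odd size, let $\varphi:\mathbb{Z}_2\to\mathrm{Aut}(N)$ be a group homomorphism, and let $G=N\rtimes_\varphi\mathbb{Z}_2$. Then, for every positive integer $k\equiv 8\pmod{10}$, every subset of type $(k/2,k/2)$ of $G\setminus\{(0,0)\}$ admits an alternating parity $4$-weak sequencing.
   Context: Groups are written additively, even when non-abelian. The group $N\rtimes_\varphi\mathbb{Z}_2$ has elements $(x,a)$ with $x\in N$, $a\in\mathbb{Z}_2$, and operation $(x_1,a_1)+(x_2,a_2)=(x_1+\varphi(a_1)(x_2),\,a_1+a_2)$; its identity is $(0,0)$. Elements $(x,0)$ are called even and elements $(x,1)$ odd. A finite subset $S$ has type $(\lambda_0,\lambda_1)$ if it contains exactly $\lambda_0$ even elements and $\lambda_1$ odd elements. A $t$-weak sequencing of a set $S$ of size $k$ is an ordering $(y_1,\ldots,y_k)$ of its elements such that the partial sums $s_0=0$ and $s_i=y_1+y_2+\cdots+y_i$ ($1\le i\le k$, sums taken in this order) satisfy $s_i\neq s_j$ for all $0\le i,j\le k$ with $1\le |i-j|\le t$. It is alternating parity if even and odd elements alternate in the ordering, i.e. any two consecutive elements have different parity. -}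

module Defs where

open import Algebra.Bundles using (Group)
open import Algebra.Morphism.Bundles using (GroupHomomorphism)
open import Algebra.Morphism.Structures using (IsGroupIsomorphism)
import Algebra.Morphism.Construct.Composition as Composition
import Algebra.Morphism.Construct.Identity as Identity
open import Data.Fin.Base using (Fin)
open import Data.List.Base using (List; length; take; foldl)
open import Data.List.Relation.Unary.Linked using (Linked)
import Data.List.Membership.Setoid as Membership
import Data.List.Relation.Unary.Unique.Setoid as UniqueSetoid
open import Data.Nat.Base using (ℕ; _≤_; ∣_-_∣; _%_)
open import Data.Parity.Base using (Parity; 0ℙ; 1ℙ)
open import Data.Parity.Properties using (+-0-group)
open import Data.Product.Base using (_×_; _,_; proj₁; proj₂; ∃)
open import Data.Product.Relation.Binary.Pointwise.NonDependent
  using (×-isEquivalence)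
open import Function.Bundles using (_⇔_; Inverse)
open import Level using (Level; 0ℓ; _⊔_)
open import Relation.Binary.Bundles using (Setoid)
open import Relation.Binary.PropositionalEquality.Core using (_≡_; _≢_)
open import Relation.Binary.PropositionalEquality.Properties using (setoid)
open import Relation.Unary using (Pred; _∩_)

private
  variable
    c ℓ d m p : Level

record Automorphism (N : Group c ℓ) : Set (c ⊔ ℓ) where
  open Group N
  field
    ⟦_⟧                : Carrier → Carrier
    isGroupIsomorphism : IsGroupIsomorphism rawGroup rawGroup ⟦_⟧
  open IsGroupIsomorphism isGroupIsomorphism public

open Automorphism using (⟦_⟧)

module _ (N : Group c ℓ) where
  open Group N
  open import Relation.Binary.Reasoning.Setoid (Group.setoid N)

  private
    module _ (f : Automorphism N) where
      module f = Automorphism f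

      inv : Carrier → Carrier
      inv y = proj₁ (f.surjective y)

      inv-right : ∀ y → f.⟦ inv y ⟧ ≈ y
      inv-right y = proj₂ (f.surjective y) refl

      inv-left : ∀ x → inv f.⟦ x ⟧ ≈ x
      inv-left x = f.injective (inv-right f.⟦ x ⟧)

      inv-cong : ∀ {x y} → x ≈ y → inv x ≈ inv y
      inv-cong {x} {y} x≈y =
        f.injective (trans (inv-right x) (trans x≈y (sym (inv-right y))))

      inverseAut : Automorphism N
      inverseAut = record
        { ⟦_⟧ = inv
        ; isGroupIsomorphism = record
          { isGroupMonomorphism = record
            { isGroupHomomorphism = record
              { isMonoidHomomorphism = record
                { isMagmaHomomorphism = record
                  { isRelHomomorphism = record { cong = inv-cong }
                  ; homo = λ x y → f.injective (begin
                      f.⟦ inv (x ∙ y) ⟧            ≈⟨ inv-right (x ∙ y) ⟩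
                      x ∙ y                        ≈⟨ ∙-cong (inv-right x) (inv-right y) ⟨
                      f.⟦ inv x ⟧ ∙ f.⟦ inv y ⟧    ≈⟨ f.∙-homo (inv x) (inv y) ⟨
                      f.⟦ inv x ∙ inv y ⟧          ∎)
                  }
                ; ε-homo = f.injective (trans (inv-right ε) (sym f.ε-homo))
                }
              ; ⁻¹-homo = λ x → f.injective (begin
                  f.⟦ inv (x ⁻¹) ⟧   ≈⟨ inv-right (x ⁻¹) ⟩
                  x ⁻¹               ≈⟨ ⁻¹-cong (inv-right x) ⟨
                  f.⟦ inv x ⟧ ⁻¹     ≈⟨ f.⁻¹-homo (inv x) ⟨
                  f.⟦ inv x ⁻¹ ⟧     ∎)
              }
            ; injective = λ {x} {y} eq → begin
                x            ≈⟨ inv-right x ⟨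
                f.⟦ inv x ⟧  ≈⟨ f.⟦⟧-cong eq ⟩
                f.⟦ inv y ⟧  ≈⟨ inv-right y ⟩
                y            ∎
            }
          ; surjective = λ x → f.⟦ x ⟧ , λ z≈fx → trans (inv-cong z≈fx) (inv-left x)
          }
        }

  Aut : Group (c ⊔ ℓ) (c ⊔ ℓ)
  Aut = record
    { Carrier = Automorphism N
    ; _≈_     = λ f g → ∀ x → ⟦ f ⟧ x ≈ ⟦ g ⟧ x
    ; _∙_     = λ f g → record
        { ⟦_⟧ = λ x → ⟦ f ⟧ (⟦ g ⟧ x)
        ; isGroupIsomorphism = Composition.isGroupIsomorphism trans
            (Automorphism.isGroupIsomorphism g) (Automorphism.isGroupIsomorphism f)
        }
    ; ε       = record
        { ⟦_⟧ = λ x → x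
        ; isGroupIsomorphism = Identity.isGroupIsomorphism rawGroup refl
        }
    ; _⁻¹     = inverseAut
    ; isGroup = record
      { isMonoid = record
        { isSemigroup = record
          { isMagma = record
            { isEquivalence = record
              { refl  = λ _ → refl
              ; sym   = λ f≈g x → sym (f≈g x)
              ; trans = λ f≈g g≈h x → trans (f≈g x) (g≈h x)
              }
            ; ∙-cong = λ {f} {g} {h} {k} f≈g h≈k x →
                trans (Automorphism.⟦⟧-cong f (h≈k x)) (f≈g (⟦ k ⟧ x))
            }
          ; assoc = λ _ _ _ _ → refl
          }
        ; identity = (λ _ _ → refl) , (λ _ _ → refl)
        }
      ; inverse = inv-left , inv-right
      ; ⁻¹-cong = λ {f} {g} f≈g x → Automorphism.injective f (begin
          ⟦ f ⟧ (inv f x)  ≈⟨ inv-right f x ⟩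
          x                ≈⟨ inv-right g x ⟨
          ⟦ g ⟧ (inv g x)  ≈⟨ f≈g (inv g x) ⟨
          ⟦ f ⟧ (inv g x)  ∎)
      }
    }

Action : Group d m → Group c ℓ → Set _
Action H N = GroupHomomorphism (Group.rawGroup H) (Group.rawGroup (Aut N))

module _ (N : Group c ℓ) (H : Group d m) (φ : Action H N) where
  private
    module N = Group N
    module H = Group H
    module φ = GroupHomomorphism φ

    act : H.Carrier → N.Carrier → N.Carrier
    act a = ⟦ φ.⟦ a ⟧ ⟧

    module act (a : H.Carrier) = Automorphism φ.⟦ a ⟧

    act-cong : ∀ {a b x y} → a H.≈ b → x N.≈ y → act a x N.≈ act b y
    act-cong {a} {y = y} a≈b x≈y =
      N.trans (act.⟦⟧-cong a x≈y) (φ.⟦⟧-cong a≈b y)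

    act-cancel : ∀ a x → act a (act (a H.⁻¹) x) N.≈ x
    act-cancel a x = N.trans (N.sym (φ.homo a (a H.⁻¹) x))
      (N.trans (φ.⟦⟧-cong (H.inverseʳ a) x) (φ.ε-homo x))

    open import Relation.Binary.Reasoning.Setoid (Group.setoid N)

  Semidirect : Group (c ⊔ d) (ℓ ⊔ m)
  Semidirect = record
    { Carrier = N.Carrier × H.Carrier
    ; _≈_     = λ (x , a) (y , b) → (x N.≈ y) × (a H.≈ b)
    ; _∙_     = λ (x₁ , a₁) (x₂ , a₂) → (x₁ N.∙ act a₁ x₂) , (a₁ H.∙ a₂)
    ; ε       = N.ε , H.ε
    ; _⁻¹     = λ (x , a) → act (a H.⁻¹) (x N.⁻¹) , a H.⁻¹
    ; isGroup = record
      { isMonoid = record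
        { isSemigroup = record
          { isMagma = record
            { isEquivalence = ×-isEquivalence N.isEquivalence H.isEquivalence
            ; ∙-cong = λ (x≈ , a≈) (y≈ , b≈) →
                N.∙-cong x≈ (act-cong a≈ y≈) , H.∙-cong a≈ b≈
            }
          ; assoc = λ (x , a) (y , b) (z , e) →
              (begin
                (x N.∙ act a y) N.∙ act (a H.∙ b) z
                  ≈⟨ N.∙-congˡ (φ.homo a b z) ⟩
                (x N.∙ act a y) N.∙ act a (act b z)
                  ≈⟨ N.assoc x (act a y) (act a (act b z)) ⟩
                x N.∙ (act a y N.∙ act a (act b z))
                  ≈⟨ N.∙-congˡ (act.∙-homo a y (act b z)) ⟨
                x N.∙ act a (y N.∙ act b z)
                  ∎) ,
              H.assoc a b e
          }
        ; identity =
            (λ (x , a) → N.trans (N.identityˡ _) (φ.ε-homo x) , H.identityˡ a) ,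
            (λ (x , a) → N.trans (N.∙-congˡ (act.ε-homo a)) (N.identityʳ x) ,
                         H.identityʳ a)
        }
      ; inverse =
          (λ (x , a) →
            N.trans (N.sym (act.∙-homo (a H.⁻¹) (x N.⁻¹) x))
              (N.trans (act.⟦⟧-cong (a H.⁻¹) (N.inverseˡ x)) (act.ε-homo (a H.⁻¹))) ,
            H.inverseˡ a) ,
          (λ (x , a) →
            N.trans (N.∙-congˡ (act-cancel a (x N.⁻¹))) (N.inverseʳ x) ,
            H.inverseʳ a)
      ; ⁻¹-cong = λ (x≈ , a≈) →
          act-cong (H.⁻¹-cong a≈) (N.⁻¹-cong x≈) , H.⁻¹-cong a≈
      }
    }

-- The raw bundle `+-0-rawGroup` in Data.Parity.Base takes the swap
-- 0ℙ ↔ 1ℙ as its inverse operation; only `+-0-group` is the group ℤ/2.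
ℤ₂ : Group 0ℓ 0ℓ
ℤ₂ = +-0-group

infix 6 _⋊ℤ₂[_]

_⋊ℤ₂[_] : (N : Group c ℓ) → Action ℤ₂ N → Group c ℓ
N ⋊ℤ₂[ φ ] = Semidirect N ℤ₂ φ

OddSize : Group c ℓ → Set (c ⊔ ℓ)
OddSize N = ∃ λ n → n % 2 ≡ 1 × Inverse (Group.setoid N) (setoid (Fin n))

module _ (A : Setoid c ℓ) where
  open Setoid A
  open Membership A using (_∈_)
  open UniqueSetoid A using (Unique)

  -- List membership is up to _≈_, so a predicate that has an ordering
  -- automatically respects _≈_.
  IsOrdering : Pred Carrier p → List Carrier → Set (c ⊔ ℓ ⊔ p)
  IsOrdering S ys = Unique ys × (∀ x → x ∈ ys ⇔ S x)

  HasSize : Pred Carrier p → ℕ → Set (c ⊔ ℓ ⊔ p)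
  HasSize S n = ∃ λ ys → IsOrdering S ys × length ys ≡ n

module _ (G : Group c ℓ) where
  open Group G

  partialSum : List Carrier → ℕ → Carrier
  partialSum ys i = foldl _∙_ ε (take i ys)

  IsWeakSequencing : ℕ → Pred Carrier p → List Carrier → Set (c ⊔ ℓ ⊔ p)
  IsWeakSequencing t S ys =
    IsOrdering (Group.setoid G) S ys ×
    (∀ i j → i ≤ length ys → j ≤ length ys →
      1 ≤ ∣ i - j ∣ → ∣ i - j ∣ ≤ t →
      partialSum ys i ≉ partialSum ys j)

module _ (N : Group c ℓ) (φ : Action ℤ₂ N) where
  private
    module G = Group (N ⋊ℤ₂[ φ ])

  Even Odd : Pred G.Carrier 0ℓ
  Even (_ , a) = a ≡ 0ℙ
  Odd  (_ , a) = a ≡ 1ℙ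

  HasType : Pred G.Carrier p → ℕ → ℕ → Set (c ⊔ ℓ ⊔ p)
  HasType S λ₀ λ₁ = HasSize G.setoid (S ∩ Even) λ₀ × HasSize G.setoid (S ∩ Odd) λ₁

  AlternatingParity : List G.Carrier → Set c
  AlternatingParity = Linked (λ g h → proj₂ g ≢ proj₂ h)

{-# OPTIONS --safe #-}
-- Written multiplicatively, and with even letters e, f and odd letters x, y, parity leaves
-- only the blocks e, x f y, e x f y and x e y f that could have product 1, and such an
-- equation determines each of its letters from the others.  So a new even element has to
-- avoid one value and a new odd element two, and a greedy choice fails only at the end.
--
-- For k ≥ 18 the sequence starts h₁ z₁ h₂ z₂ h₃ z₃ with h₁, h₂, h₃ left open.  The values that
-- the letters around them forbid for h₂ and h₃ are used up early, and the last two odd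
-- elements are placed while five even ones remain.  The three left over fill the open places
-- unless α h = (z₁ h z₂)⁻¹ permutes them cyclically; since N has no involution, the last two
-- places can be filled so that this does not happen.
--
-- For k = 8 suppose that every sequence of the four even and four odd elements is blocked.
-- The equations x a y b = 1 (a, b even or 1) with a common part interact: x a = y b may be
-- substituted, and x a = y b together with x b = y a would make a b⁻¹ an involution.  A finite
-- case analysis, up to relabelling, excludes first the equations x a y = 1, then x a y b = 1.
module Submission where

open import Defs
open import Algebra.Bundles using (Group)
open import Algebra.Morphism.Bundles using (GroupHomomorphism)
import Algebra.Properties.Group as GroupProperties
open import Data.Empty using (⊥-elim)
open import Data.Fin.Base using (Fin; zero; suc; punchIn; punchOut)
open import Data.Fin.Patterns
import Data.Fin.Properties as Fin
open import Data.List.Base using (List; []; _∷_; _++_; length; map; take; drop; foldl; allFin)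
open import Data.List.Membership.Propositional using (_∈_)
open import Data.List.Membership.Propositional.Properties using (∈-allFin)
import Data.List.Properties as List
open import Data.List.Relation.Binary.Permutation.Propositional
  using (_↭_; ↭-refl; ↭-reflexive; ↭-sym; ↭-trans; prep; swap; ↭⇒↭ₛ)
open import Data.List.Relation.Binary.Permutation.Propositional.Properties
  using (All-resp-↭; Any-resp-↭; ∈-resp-↭; ↭-length; ++⁺; ++⁺ˡ; ++-comm; shift)
  renaming (map⁺ to ↭-map⁺)
import Data.List.Relation.Binary.Permutation.Setoid.Properties as ↭ₛ
open import Data.List.Relation.Unary.All as All using (All; []; _∷_)
import Data.List.Relation.Unary.All.Properties as All
open import Data.List.Relation.Unary.AllPairs using ([]; _∷_)
import Data.List.Relation.Unary.AllPairs.Properties as AllPairs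
open import Data.List.Relation.Unary.Any as Any using (Any; any?; here; there)
import Data.List.Relation.Unary.Any.Properties as Any
open import Data.List.Relation.Unary.Linked using (Linked; []; [-]; _∷_)
import Data.List.Relation.Unary.Unique.Propositional.Properties as Unique
import Data.List.Relation.Unary.Unique.Setoid as UniqueSetoid
open import Data.List.Sort.Base using (module SortingAlgorithm)
import Data.List.Sort.InsertionSort as InsertionSort
open import Data.Maybe.Base as Maybe using (Maybe; just; nothing; _<∣>_)
open import Data.Nat.Base
  using (ℕ; zero; suc; _+_; _*_; _∸_; _/_; _%_; _≤_; _<_; z≤n; s≤s; s≤s⁻¹; ∣_-_∣)
open import Data.Nat.Divisibility using (_∣_; _∣0; ∣-refl; ∣m∣n⇒∣m+n; n∣m⇒m%n≡0)
open import Data.Nat.DivMod using (m≡m%n+[m/n]*n; m*n/n≡m)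
open import Data.Nat.Properties
  using (suc-injective; <⇒≤; ≤-refl; ≤-trans; ≤-total; m≤m+n; m≤n+m; m+n∸m≡n; m+[n∸m]≡n;
         m≤n⇒m⊓n≡m; m≤n⇒∣m-n∣≡n∸m; m≤n⇒∣n-m∣≡n∸m; +-comm; *-assoc; *-distribʳ-+)
open import Data.Parity.Base as ℙ using (Parity; 0ℙ; 1ℙ)
import Data.Parity.Properties as ℙ using (_≟_)
open import Data.Product.Base using (_×_; _,_; proj₁; proj₂; ∃; ∃₂; ∃-syntax)
open import Data.Sum.Base using (_⊎_; inj₁; inj₂)
open import Data.Unit.Polymorphic.Base using (⊤; tt)
open import Data.Vec.Base as Vec using (Vec; []; _∷_; lookup; toList)
open import Data.Vec.Properties using (lookup-map; toList-map)
open import Function.Base using (_∘_; _$_; _on_)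
open import Function.Bundles using (Inverse; Equivalence; _⇔_; mk⇔)
open import Level using (Level; _⊔_)
open import Relation.Binary.Definitions using (Decidable)
open import Relation.Binary.PropositionalEquality as ≡ using (_≡_; _≢_)
open import Relation.Nullary.Decidable using (Dec; yes; no; dec⇒maybe; map′; _×-dec_)
open import Relation.Nullary.Negation using (¬_)
open import Relation.Unary using (Pred; _∉_; _∩_)

-- Choice from finite lists of distinct elements.

extract : ∀ {a p} {A : Set a} {P : A → Set p} {xs} → Any P xs →
          ∃₂ λ x ys → xs ↭ x ∷ ys × P x
extract {xs = x ∷ xs} (here px) = x , xs , ↭-refl , px
extract {xs = x ∷ xs} (there a) with extract a
... | y , ys , xs↭ , py = y , x ∷ ys , ↭-trans (prep x xs↭) (swap x y ↭-refl) , py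

module Pool {c ℓ} (G : Group c ℓ) (_≟_ : Decidable (Group._≈_ G)) where
  open Group G
  open UniqueSetoid setoid using (Unique)

  ≉-sym : ∀ {x y} → x ≉ y → y ≉ x
  ≉-sym x≉y = x≉y ∘ sym

  Unique-resp-↭ : ∀ {xs ys} → xs ↭ ys → Unique xs → Unique ys
  Unique-resp-↭ xs↭ys = ↭ₛ.AllPairs-resp-↭ (≡.setoid Carrier) ≉-sym
    ((λ { ≡.refl x≉ → x≉ }) , (λ { ≡.refl x≉ → x≉ })) (↭⇒↭ₛ xs↭ys)

  -- A forbidden value equals at most one listed element, so setting that element aside costs one
  -- entry of the list for one entry of `vs`.
  avoid : ∀ vs {xs} → Unique xs → length vs < length xs →
          ∃₂ λ x ys → xs ↭ x ∷ ys × All (x ≉_) vs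
  avoid []       {x ∷ xs} _    _  = x , xs , ↭-refl , []
  avoid (v ∷ vs) {xs}     uniq lt with any? (_≟ v) xs
  ... | no v∉xs with avoid vs uniq (<⇒≤ lt)
  ...   | x , ys , xs↭ , x∉vs =
    x , ys , xs↭ , All.head (All-resp-↭ xs↭ (All.¬Any⇒All¬ xs v∉xs)) ∷ x∉vs
  avoid (v ∷ vs) {xs} uniq lt | yes v∈xs with extract v∈xs
  ... | w , ys , xs↭ , w≈v with Unique-resp-↭ xs↭ uniq
  ...   | w∉ys ∷ uniq′ with avoid vs uniq′ (s≤s⁻¹ (≡.subst (_ <_) (↭-length xs↭) lt))
  ...     | x , zs , ys↭ , x∉vs =
    x , w ∷ zs , ↭-trans xs↭ (↭-trans (prep w ys↭) (swap w x ↭-refl)) ,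
    (λ x≈v → All.head (All-resp-↭ ys↭ w∉ys) (trans w≈v (sym x≈v))) ∷ x∉vs

  Supply : ℕ → List Carrier → Set _
  Supply n xs = Unique xs × length xs ≡ n

  draw : ∀ {n x xs ys} → xs ↭ x ∷ ys → Supply (suc n) xs → Supply n ys
  draw xs↭ (unique , size) with Unique-resp-↭ xs↭ unique
  ... | _ ∷ unique′ = unique′ , suc-injective (≡.trans (≡.sym (↭-length xs↭)) size)

  split-at : ∀ m n {xs} → Supply (m + n) xs → Supply n (drop m xs) × length (take m xs) ≡ m
  split-at m n {xs} (unique , size) =
    ( AllPairs.drop⁺ m unique
    , ≡.trans (List.length-drop m xs) (≡.trans (≡.cong (_∸ m) size) (m+n∸m≡n m n))) ,
    ≡.trans (List.length-take m xs) (m≤n⇒m⊓n≡m (≡.subst (m ≤_) (≡.sym size) (m≤m+n m n)))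

  -- By distinctness at most one element equals `v`; spending it early frees all later choices from
  -- the value `v`. If there is none, an arbitrary element is spent, so that the sizes agree in both
  -- cases.
  exhaust : ∀ {n} v {xs} → Supply (suc n) xs →
            ∃[ x ] ∃[ ys ] xs ↭ x ∷ ys × Supply n ys × All (_≉ v) ys
  exhaust v {x ∷ xs} supply@(unique , _) with any? (_≟ v) (x ∷ xs)
  ... | no v∉xs = x , xs , ↭-refl , draw ↭-refl supply , All.tail (All.¬Any⇒All¬ (x ∷ xs) v∉xs)
  ... | yes v∈xs with extract v∈xs
  ...   | w , ys , xs↭ , w≈v with Unique-resp-↭ xs↭ unique
  ...     | w∉ys ∷ _ = w , ys , xs↭ , draw xs↭ supply ,
    All.map (λ w≉y y≈v → w≉y (trans w≈v (sym y≈v))) w∉ys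

-- Words of syllables and the blocks whose product must not be 1.

module Words {c ℓ} (G : Group c ℓ) where
  open Group G
  open GroupProperties G

  -- A word e₁ x₁ e₂ x₂ … with even eᵢ and odd xᵢ is the list of its pairs (eᵢ , xᵢ).
  Syllable : Set c
  Syllable = Carrier × Carrier

  Step : Syllable → Syllable → Set ℓ
  Step (e , x) (f , y) = x ∙ f ∙ y ≉ ε × e ∙ x ∙ f ∙ y ≉ ε

  -- The conditions on ps as a continuation of a word ending in p e q.
  Chain : Carrier → Syllable → List Syllable → Set ℓ
  Chain p (e , q) []             = ⊤
  Chain p (e , q) ((f , x) ∷ ps) =
    p ∙ e ∙ q ∙ f ≉ ε × Step (e , q) (f , x) × Chain q (f , x) ps

  -- The first syllable has no predecessor, so it enters through `Step`, and the blocks `p e q f`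
  -- begin with its odd letter. Blocks of one even letter are covered by `Proper`.
  Valid : List Syllable → Set ℓ
  Valid []           = ⊤
  Valid (_ ∷ [])     = ⊤
  Valid (a ∷ b ∷ ps) = Step a b × Chain (proj₂ a) b ps

  rotate : ∀ {a b} → a ∙ b ≈ ε → b ∙ a ≈ ε
  rotate {a} {b} ab≈ε = trans (∙-congʳ (inverseʳ-unique a b ab≈ε)) (inverseˡ a)

  last-avoids : ∀ {w x} → x ≉ w ⁻¹ → w ∙ x ≉ ε
  last-avoids x≉ = x≉ ∘ inverseʳ-unique _ _

  first-avoids : ∀ {w x} → x ≉ w ⁻¹ → x ∙ w ≉ ε
  first-avoids x≉ = x≉ ∘ inverseˡ-unique _ _

  -- Conjugation turns `u x v = 1` into `x v u = 1`, which leaves a single forbidden value for `x`.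
  middle-avoids : ∀ {u x v} → x ≉ (v ∙ u) ⁻¹ → u ∙ x ∙ v ≉ ε
  middle-avoids {u} {x} {v} x≉ uxv≈ε = x≉ (inverseˡ-unique _ _
    (trans (sym (assoc x v u)) (rotate (trans (sym (assoc u x v)) uxv≈ε))))

-- The last two syllables and the three open places.

two : ∀ {a} {A : Set a} (xs : List A) → length xs ≡ 2 → ∃₂ λ x y → xs ≡ x ∷ y ∷ []
two (x ∷ y ∷ []) _ = x , y , ≡.refl

three : ∀ {a} {A : Set a} (xs : List A) → length xs ≡ 3 →
        ∃[ x ] ∃[ y ] ∃[ z ] xs ≡ x ∷ y ∷ z ∷ []
three (x ∷ y ∷ z ∷ []) _ = x , y , z , ≡.refl

module Tail {c ℓ} (G : Group c ℓ) (_≟_ : Decidable (Group._≈_ G)) where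
  open Group G
  open GroupProperties G
  open UniqueSetoid setoid using (Unique)
  open Words G
  open Pool G _≟_

  append : ∀ p e q x {xs} → Unique xs → 3 < length xs →
           ∃₂ λ f ys → xs ↭ f ∷ ys × p ∙ e ∙ q ∙ f ≉ ε × Step (e , q) (f , x)
  append p e q x uniq lt
    with avoid ((p ∙ e ∙ q) ⁻¹ ∷ (x ∙ q) ⁻¹ ∷ (x ∙ (e ∙ q)) ⁻¹ ∷ []) uniq lt
  ... | f , ys , xs↭ , f≉₁ ∷ f≉₂ ∷ f≉₃ ∷ [] =
    f , ys , xs↭ , last-avoids f≉₁ , middle-avoids f≉₂ , middle-avoids f≉₃

  -- In h₁ z₁ h₂ z₂ h₃ z₃ the neighbours of h₂ must differ from α h₂ = (z₁ h₂ z₂)⁻¹, and h₃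
  -- from γ h₂ = (z₃ h₂ z₂)⁻¹.
  module _ (α γ : Carrier → Carrier) (α-injective : ∀ {x y} → α x ≈ α y → x ≈ y) where

    Fits : List Carrier → Set _
    Fits xs = ∃[ h₁ ] ∃[ h₂ ] ∃[ h₃ ]
      xs ↭ h₁ ∷ h₂ ∷ h₃ ∷ [] × h₁ ≉ α h₂ × h₃ ≉ α h₂ × h₃ ≉ γ h₂

    Fits-resp-↭ : ∀ {xs ys} → xs ↭ ys → Fits ys → Fits xs
    Fits-resp-↭ xs↭ys (h₁ , h₂ , h₃ , ys↭ , fits) =
      h₁ , h₂ , h₃ , ↭-trans xs↭ys ys↭ , fits

    -- At most one of `k` and `l` equals `γ h`; the other one goes to the right of `h`.
    fits : ∀ {h k l} → k ≉ l → k ≉ α h → l ≉ α h → Fits (h ∷ k ∷ l ∷ [])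
    fits {h} {k} {l} k≉l k≉ l≉ with l ≟ γ h
    ... | no  l≉γ = k , h , l , swap h k ↭-refl , k≉ , l≉ , l≉γ
    ... | yes l≈γ = l , h , k , ↭-trans (prep h (swap k l ↭-refl)) (swap h l ↭-refl) ,
      l≉ , k≉ , λ k≈γ → k≉l (trans k≈γ (sym l≈γ))

    Cyclic : Carrier → Carrier → Carrier → Set ℓ
    Cyclic a b c = α a ≈ b × α b ≈ c × α c ≈ a

    -- An element can be the centre unless `α` sends it to one of the other two. If all three fail,
    -- injectivity of `α` leaves only the two 3-cycles.
    fits-or-cyclic : ∀ {a b c} → Unique (a ∷ b ∷ c ∷ []) →
      Fits (a ∷ b ∷ c ∷ []) ⊎
      ∃[ x ] ∃[ y ] ∃[ z ] a ∷ b ∷ c ∷ [] ↭ x ∷ y ∷ z ∷ [] × Cyclic x y z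
    fits-or-cyclic {a} {b} {c} ((a≉b ∷ a≉c ∷ []) ∷ (b≉c ∷ []) ∷ [] ∷ []) =
      centre-a
      where
      Goal : List Carrier → Set _
      Goal xs = Fits xs ⊎ ∃[ x ] ∃[ y ] ∃[ z ] xs ↭ x ∷ y ∷ z ∷ [] × Cyclic x y z

      from-image : ∀ {a b c} → a ≉ b → a ≉ c → b ≉ c → b ≈ α a → Goal (a ∷ b ∷ c ∷ [])
      from-image {a} {b} {c} a≉b a≉c b≉c b≈αa with a ≟ α c
      ... | no a≉αc = inj₁ (Fits-resp-↭
        (↭-trans (prep a (swap b c ↭-refl)) (swap a c ↭-refl))
        (fits a≉b a≉αc (λ b≈αc → a≉c (α-injective (trans (sym b≈αa) b≈αc)))))
      ... | yes a≈αc with c ≟ α b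
      ...   | yes c≈αb = inj₂ (a , b , c , ↭-refl , sym b≈αa , sym c≈αb , sym a≈αc)
      ...   | no  c≉αb = inj₁ (Fits-resp-↭ (swap a b ↭-refl)
        (fits a≉c (λ a≈αb → b≉c (α-injective (trans (sym a≈αb) a≈αc))) c≉αb))

      Goal-resp-↭ : ∀ {xs ys} → xs ↭ ys → Goal ys → Goal xs
      Goal-resp-↭ p (inj₁ f)                   = inj₁ (Fits-resp-↭ p f)
      Goal-resp-↭ p (inj₂ (x , y , z , q , r)) = inj₂ (x , y , z , ↭-trans p q , r)

      centre-a : Goal (a ∷ b ∷ c ∷ [])
      centre-a with b ≟ α a
      ... | yes b≈αa = from-image a≉b a≉c b≉c b≈αa
      ... | no  b≉αa with c ≟ α a
      ...   | yes c≈αa =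
        Goal-resp-↭ (prep a (swap b c ↭-refl)) (from-image a≉c a≉b (≉-sym b≉c) c≈αa)
      ...   | no  c≉αa = inj₁ (fits b≉c b≉αa c≉αa)

    module _ (p e q : Carrier) (e²≈ε⇒e≈ε : e ∙ e ≈ ε → e ≈ ε) where

      Tail : List Carrier → List Carrier → Set _
      Tail es xs = ∃[ f ] ∃[ g ] ∃[ x ] ∃[ y ] ∃[ hs ]
        es ↭ f ∷ g ∷ hs × xs ↭ x ∷ y ∷ [] × Fits hs ×
        Chain p (e , q) ((f , x) ∷ (g , y) ∷ [])

      Allowed : Carrier → Carrier → Set ℓ
      Allowed f x = p ∙ e ∙ q ∙ f ≉ ε × Step (e , q) (f , x)

      -- Only β = (p e q)⁻¹, (u q)⁻¹ and (u e q)⁻¹ are excluded before u, only β, (v q)⁻¹ and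
      -- (v e q)⁻¹ before v.  If these were the same three values, then u = v e and v = u e.
      allowed : ∀ {u v xs} → u ≉ v → Unique xs → 2 < length xs →
        ∃[ f ] f ∈ xs × (Allowed f u ⊎ Allowed f v)
      allowed {u} {v} u≉v uniq lt with s ≟ t′
        where
        s = (u ∙ q) ⁻¹
        t′ = (v ∙ (e ∙ q)) ⁻¹
      ... | no s≉t′ with avoid ((p ∙ e ∙ q) ⁻¹ ∷ (u ∙ (e ∙ q)) ⁻¹ ∷ []) uniq lt
      ...   | f , ys , xs↭ , f≉₁ ∷ f≉₂ ∷ [] with f ≟ ((u ∙ q) ⁻¹)
      ...     | no  f≉s = f , ∈-resp-↭ (↭-sym xs↭) (here ≡.refl) ,
        inj₁ (last-avoids f≉₁ , middle-avoids f≉s , middle-avoids f≉₂)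
      ...     | yes f≈s = f , ∈-resp-↭ (↭-sym xs↭) (here ≡.refl) ,
        inj₂ (last-avoids f≉₁ ,
              middle-avoids (λ f≈s′ → u≉v (∙-cancelʳ q u v (⁻¹-injective (trans (sym f≈s) f≈s′)))) ,
              middle-avoids (λ f≈t′ → s≉t′ (trans (sym f≈s) f≈t′)))
      allowed {u} {v} u≉v uniq lt | yes s≈t′ with ((u ∙ (e ∙ q)) ⁻¹) ≟ ((v ∙ q) ⁻¹)
      ... | yes t≈s′ = ⊥-elim (u≉v (trans u≈ve (trans (∙-congˡ e≈ε) (identityʳ v))))
        where
        u≈ve : u ≈ v ∙ e
        u≈ve = ∙-cancelʳ q _ _ (trans (⁻¹-injective s≈t′) (sym (assoc v e q)))
        ue≈v : u ∙ e ≈ v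
        ue≈v = ∙-cancelʳ q _ _ (trans (assoc u e q) (⁻¹-injective t≈s′))
        e≈ε : e ≈ ε
        e≈ε = e²≈ε⇒e≈ε (identityʳ-unique v (e ∙ e)
          (trans (sym (assoc v e e)) (trans (∙-congʳ (sym u≈ve)) ue≈v)))
      ... | no t≉s′ with avoid ((p ∙ e ∙ q) ⁻¹ ∷ (u ∙ q) ⁻¹ ∷ []) uniq lt
      ...   | f , ys , xs↭ , f≉₁ ∷ f≉₂ ∷ [] with f ≟ ((u ∙ (e ∙ q)) ⁻¹)
      ...     | no  f≉t = f , ∈-resp-↭ (↭-sym xs↭) (here ≡.refl) ,
        inj₁ (last-avoids f≉₁ , middle-avoids f≉₂ , middle-avoids f≉t)
      ...     | yes f≈t = f , ∈-resp-↭ (↭-sym xs↭) (here ≡.refl) ,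
        inj₂ (last-avoids f≉₁ ,
              middle-avoids (λ f≈s′ → t≉s′ (trans (sym f≈t) f≈s′)) ,
              middle-avoids (λ f≈t′ → u≉v (∙-cancelʳ (e ∙ q) u v
                (⁻¹-injective (trans (sym f≈t) f≈t′)))))

      -- With a used up, c fits between any two others; if c is used up as well, b does.
      tail-cyclic : ∀ {a b c d f x y es xs} → Unique es →
        es ↭ a ∷ b ∷ c ∷ d ∷ f ∷ [] → xs ↭ x ∷ y ∷ [] → Cyclic a b c → Allowed a x →
        Tail es xs
      tail-cyclic {a} {b} {c} {d} {f} {x} {y} uniq es↭ xs↭ (αa≈b , αb≈c , αc≈a) (turn , step)
        with Unique-resp-↭ es↭ uniq
      ... | a∉ ∷ uniq′@((b≉c ∷ _) ∷ _) with append q a x y uniq′ (s≤s (s≤s (s≤s (s≤s z≤n))))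
      ...   | g , hs , ↭g∷hs , turn′ , step′ =
        a , g , x , y , hs , ↭-trans es↭ (prep a ↭g∷hs) , xs↭ ,
        remaining hs ↭g∷hs (∈-resp-↭ ↭g∷hs (there (here ≡.refl))) (∈-resp-↭ ↭g∷hs (here ≡.refl)) ,
        turn , step , turn′ , step′ , tt
        where
        around : ∀ {h w hs} → h ∈ hs → length hs ≡ 3 → Unique hs → All (w ≉_) hs →
                 α h ≈ w → Fits hs
        around h∈hs len uniq w∉hs αh≈w with extract h∈hs
        ... | h , ks , hs↭ , ≡.refl with two ks (suc-injective (≡.trans (≡.sym (↭-length hs↭)) len))
        ...   | k , l , ≡.refl with Unique-resp-↭ hs↭ uniq | All-resp-↭ hs↭ w∉hs
        ...     | _ ∷ (k≉l ∷ []) ∷ _ | _ ∷ w≉k ∷ w≉l ∷ [] = Fits-resp-↭ hs↭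
          (fits k≉l (λ k≈ → w≉k (sym (trans k≈ αh≈w))) (λ l≈ → w≉l (sym (trans l≈ αh≈w))))

        remaining : ∀ {g} hs → b ∷ c ∷ d ∷ f ∷ [] ↭ g ∷ hs → c ∈ g ∷ hs → b ∈ g ∷ hs → Fits hs
        remaining hs p (there c∈hs) _ with Unique-resp-↭ p uniq′
        ... | _ ∷ uniq″ = around c∈hs (suc-injective (≡.sym (↭-length p))) uniq″
          (All.tail (All-resp-↭ p a∉)) αc≈a
        remaining hs p (here ≡.refl) (here ≡.refl) = ⊥-elim (b≉c refl)
        remaining hs p (here ≡.refl) (there b∈hs) with Unique-resp-↭ p uniq′
        ... | c∉hs ∷ uniq″ = around b∈hs (suc-injective (≡.sym (↭-length p))) uniq″ c∉hs αb≈c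

      -- The two even places are first filled greedily. If `α` permutes the three leftovers
      -- cyclically, one of them is moved to the first place, before `u` or before `v`, which breaks
      -- the cycle.
      tail : ∀ {es u v} → Unique es → length es ≡ 5 → u ≉ v → Tail es (u ∷ v ∷ [])
      tail {es} {u} {v} uniq len u≉v
        with append p e q u uniq (≡.subst (3 <_) (≡.sym len) (s≤s (s≤s (s≤s (s≤s z≤n)))))
      ... | d , rs , es↭ , turn , step with Unique-resp-↭ es↭ uniq | ≡.trans (≡.sym (↭-length es↭)) len
      ...   | _ ∷ uniq₁ | len₁
            with append q d u v uniq₁ (≡.subst (3 <_) (≡.sym (suc-injective len₁)) ≤-refl)
      ...     | f , hs , rs↭ , turn′ , step′
              with three hs (suc-injective (suc-injective
                     (≡.trans (≡.sym (↭-length (↭-trans es↭ (prep d rs↭)))) len)))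
      ...       | a , b , c , ≡.refl with Unique-resp-↭ rs↭ uniq₁
      ...         | _ ∷ uniq₂ with fits-or-cyclic uniq₂
      ...           | inj₁ fit =
        d , f , u , v , _ , ↭-trans es↭ (prep d rs↭) , ↭-refl , fit , turn , step , turn′ , step′ , tt
      ...           | inj₂ (x , y , z , hs↭ , cyc@(αx≈y , αy≈z , αz≈x))
                    with allowed u≉v (Unique-resp-↭ hs↭ uniq₂) ≤-refl
      ...             | h , h∈ , ok = from h∈ ok
        where
        es↭xyz : es ↭ x ∷ y ∷ z ∷ d ∷ f ∷ []
        es↭xyz = ↭-trans es↭ (↭-trans (prep d (↭-trans rs↭ (prep f hs↭)))
          (++-comm (d ∷ f ∷ []) (x ∷ y ∷ z ∷ [])))

        rotate₃ : ∀ {x y z : Carrier} {ds} → x ∷ y ∷ z ∷ ds ↭ y ∷ z ∷ x ∷ ds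
        rotate₃ {x} {y} {z} = ↭-trans (swap x y ↭-refl) (prep y (swap x z ↭-refl))

        go : ∀ {a b c} → es ↭ a ∷ b ∷ c ∷ d ∷ f ∷ [] → Cyclic a b c →
             Allowed a u ⊎ Allowed a v → Tail es (u ∷ v ∷ [])
        go p cyc (inj₁ ok) = tail-cyclic uniq p ↭-refl cyc ok
        go p cyc (inj₂ ok) = tail-cyclic uniq p (swap u v ↭-refl) cyc ok

        from : ∀ {h} → h ∈ x ∷ y ∷ z ∷ [] → Allowed h u ⊎ Allowed h v → Tail es (u ∷ v ∷ [])
        from (here ≡.refl)                 = go es↭xyz cyc
        from (there (here ≡.refl))         = go (↭-trans es↭xyz rotate₃) (αy≈z , αz≈x , αx≈y)
        from (there (there (here ≡.refl))) =
          go (↭-trans es↭xyz (↭-trans rotate₃ rotate₃)) (αz≈x , αx≈y , αy≈z)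

-- Arrangements of at least nine syllables.

module Long {c ℓ} (G : Group c ℓ) (_≟_ : Decidable (Group._≈_ G)) where
  open Group G
  open GroupProperties G
  open UniqueSetoid setoid using (Unique)
  open Words G
  open Pool G _≟_
  open Tail G _≟_

  assoc₄ : ∀ a b c d → a ∙ b ∙ c ∙ d ≈ a ∙ (b ∙ c ∙ d)
  assoc₄ a b c d = trans (∙-congʳ (assoc a b c)) (assoc a (b ∙ c) d)

  -- The empty case is trivial because `tail` then chooses the next even letter itself and takes
  -- care of this block.
  Turn : Carrier → Carrier → Carrier → List Carrier → Set ℓ
  Turn p e q []      = ⊤
  Turn p e q (g ∷ _) = p ∙ e ∙ q ∙ g ≉ ε

  NoInvolution : Carrier → Set ℓ
  NoInvolution e = e ∙ e ≈ ε → e ≈ ε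

  module _ (α γ : Carrier → Carrier) (α-injective : ∀ {x y} → α x ≈ α y → x ≈ y) where

    -- The even letters `gs` keep their order and the odd ones are chosen greedily. `Step` forbids
    -- two values, and a third is forbidden by `Turn` while another prescribed letter follows. At
    -- least four odd letters are available in that case, three before the last prescribed letter,
    -- and two remain for `tail`.
    extend : ∀ p e q gs {es xs} → Turn p e q gs → All NoInvolution (e ∷ gs) →
      Unique xs → length xs ≡ 2 + length gs → Unique es → length es ≡ 5 →
      ∃[ ps ] ∃[ fs ] ∃[ hs ] Chain p (e , q) ps × Fits α γ α-injective hs ×
        map proj₁ ps ↭ gs ++ fs × es ↭ fs ++ hs × map proj₂ ps ↭ xs
    extend p e q [] {xs = xs} _ (e²≈ε⇒e≈ε ∷ []) uxs |xs| ues |es| with two xs |xs|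
    ... | u , v , ≡.refl with uxs
    ...   | (u≉v ∷ []) ∷ _ with tail α γ α-injective p e q e²≈ε⇒e≈ε ues |es| u≉v
    ...     | f , g , x , y , hs , es↭ , xs↭ , fit , chain =
      _ , f ∷ g ∷ [] , hs , chain , fit , ↭-refl , es↭ , ↭-sym xs↭
    extend p e q (g ∷ []) {es} {xs} turn (_ ∷ inv) uxs |xs| ues |es|
      with avoid ((q ∙ g) ⁻¹ ∷ (e ∙ q ∙ g) ⁻¹ ∷ []) uxs (≡.subst (2 <_) (≡.sym |xs|) ≤-refl)
    ... | x , ys , xs↭ , x≉₁ ∷ x≉₂ ∷ [] with draw xs↭ (uxs , |xs|)
    ...   | uys , |ys| with extend q g x [] tt inv uys |ys| ues |es|
    ...     | ps , fs , hs , chain , fit , ps₁↭ , es↭ , ps₂↭ =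
      (g , x) ∷ ps , fs , hs , (turn , (last-avoids x≉₁ , last-avoids x≉₂) , chain) , fit ,
      prep g ps₁↭ , es↭ , ↭-trans (prep x ps₂↭) (↭-sym xs↭)
    extend p e q (g ∷ gs@(g′ ∷ _)) {es} {xs} turn (_ ∷ inv) uxs |xs| ues |es|
      with avoid ((q ∙ g) ⁻¹ ∷ (e ∙ q ∙ g) ⁻¹ ∷ (g′ ∙ (q ∙ g)) ⁻¹ ∷ []) uxs
             (≡.subst (3 <_) (≡.sym |xs|) (s≤s (s≤s (s≤s (s≤s z≤n)))))
    ... | x , ys , xs↭ , x≉₁ ∷ x≉₂ ∷ x≉₃ ∷ [] with draw xs↭ (uxs , |xs|)
    ...   | uys , |ys| with extend q g x gs (middle-avoids x≉₃) inv uys |ys| ues |es|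
    ...     | ps , fs , hs , chain , fit , ps₁↭ , es↭ , ps₂↭ =
      (g , x) ∷ ps , fs , hs , (turn , (last-avoids x≉₁ , last-avoids x≉₂) , chain) , fit ,
      prep g ps₁↭ , es↭ , ↭-trans (prep x ps₂↭) (↭-sym xs↭)

  Arrangement : List Carrier → List Carrier → Set _
  Arrangement es xs = ∃[ ps ] Valid ps × map proj₁ ps ↭ es × map proj₂ ps ↭ xs

  -- In order of exhaustion, the values excluded by z₁ h₂ z₂, z₂ h₃ z₃, z₂ h₃ z₃ e, h₃ z₃ e x.
  long : ∀ n {es xs} → Unique es → Unique xs →
    length es ≡ 4 + (n + 5) → length xs ≡ 4 + (n + 5) →
    All NoInvolution es → Arrangement es xs
  long n {es} {z₁ ∷ z₂ ∷ z₃ ∷ xs} ues (_ ∷ _ ∷ _ ∷ uxs) |es| |xs| inv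
    with exhaust ((z₂ ∙ z₁) ⁻¹) (ues , |es|)
  ... | e , es₁ , es↭ , s₁ , ≉₁ with exhaust ((z₃ ∙ z₂) ⁻¹) s₁
  ...   | g₁ , es₂ , es₁↭ , s₂ , ≉₂ with exhaust ((z₃ ∙ e ∙ z₂) ⁻¹) s₂
  ...     | g₂ , es₃ , es₂↭ , s₃ , ≉₃
          -- The block `h₃ z₃ e x` cannot constrain `x` yet, since `h₃` is open; it constrains `h₃`
          -- instead, through the exhaustion that yields `g₃`.
          with avoid ((z₃ ∙ e) ⁻¹ ∷ (g₁ ∙ (z₃ ∙ e)) ⁻¹ ∷ []) uxs
                 (≡.subst (2 <_) (≡.sym |xs|′) (s≤s (≤-trans (s≤s (s≤s z≤n)) (m≤n+m 5 n))))
    where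
    |xs|′ : length xs ≡ suc (n + 5)
    |xs|′ = suc-injective (suc-injective (suc-injective |xs|))
  ...       | x , ys , xs↭ , x≉₁ ∷ x≉₂ ∷ [] with exhaust ((z₃ ∙ e ∙ x) ⁻¹) s₃
  ...         | g₃ , es₄ , es₃↭ , s₄ , ≉₄ = conclude
    where
    es↭′ : es ↭ e ∷ g₁ ∷ g₂ ∷ g₃ ∷ es₄
    es↭′ = ↭-trans es↭ (prep e (↭-trans es₁↭ (prep g₁ (↭-trans es₂↭ (prep g₂ es₃↭)))))

    -- Of the `n + 5` even letters left, `n` are prescribed; the other five serve the last two
    -- syllables and the three open places.
    rest = drop n es₄
    gs = g₁ ∷ g₂ ∷ g₃ ∷ take n es₄

    es↭gs++rest : es ↭ e ∷ gs ++ rest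
    es↭gs++rest = ↭-trans es↭′
      (↭-reflexive (≡.cong (λ es → e ∷ g₁ ∷ g₂ ∷ g₃ ∷ es) (≡.sym (List.take++drop≡id n es₄))))

    supply-ys : Supply (5 + n) ys
    supply-ys = draw xs↭
      (uxs , ≡.trans (suc-injective (suc-injective (suc-injective |xs|))) (≡.cong suc (+-comm n 5)))

    α γ : Carrier → Carrier
    α h = (z₁ ∙ h ∙ z₂) ⁻¹
    γ h = (z₃ ∙ (h ∙ z₂)) ⁻¹

    α-injective : ∀ {x y} → α x ≈ α y → x ≈ y
    α-injective αx≈αy = ∙-cancelˡ z₁ _ _ (∙-cancelʳ z₂ _ _ (⁻¹-injective αx≈αy))

    conclude : Arrangement es (z₁ ∷ z₂ ∷ z₃ ∷ xs)
    conclude with split-at n 5 s₄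
    ... | (urest , |rest|) , |take|
        with extend α γ α-injective z₃ e x gs (middle-avoids x≉₂)
               (All.++⁻ˡ (e ∷ gs) (All-resp-↭ es↭gs++rest inv))
               (proj₁ supply-ys) (≡.trans (proj₂ supply-ys) (≡.cong (5 +_) (≡.sym |take|))) urest |rest|
    ...   | ps , fs , hs , chain , (h₁ , h₂ , h₃ , hs↭ , h₁≉α , h₃≉α , h₃≉γ) , ps₁↭ , rest↭ , ps₂↭
          with avoided ≉₁₄ | avoided ≉₂₄ | avoided ≉₃₄ | avoided ≉₄
      where
      ≉₃₄ : All (_≉ (z₃ ∙ e ∙ z₂) ⁻¹) es₄
      ≉₃₄ = All.tail (All-resp-↭ es₃↭ ≉₃)
      ≉₂₄ : All (_≉ (z₃ ∙ z₂) ⁻¹) es₄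
      ≉₂₄ = All.tail (All-resp-↭ es₃↭ (All.tail (All-resp-↭ es₂↭ ≉₂)))
      ≉₁₄ : All (_≉ (z₂ ∙ z₁) ⁻¹) es₄
      ≉₁₄ = All.tail (All-resp-↭ es₃↭ (All.tail (All-resp-↭ es₂↭ (All.tail (All-resp-↭ es₁↭ ≉₁)))))
      avoided : ∀ {p} {P : Carrier → Set p} → All P es₄ → All P (h₁ ∷ h₂ ∷ h₃ ∷ [])
      avoided all = All-resp-↭ hs↭ (All.++⁻ʳ fs (All-resp-↭ rest↭ (All.drop⁺ n all)))
    ...     | _ ∷ h₂≉₁ ∷ _ | _ ∷ _ ∷ h₃≉₂ ∷ _ | _ ∷ _ ∷ h₃≉₃ ∷ _ | _ ∷ _ ∷ h₃≉₄ ∷ _ =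
      (h₁ , z₁) ∷ (h₂ , z₂) ∷ (h₃ , z₃) ∷ (e , x) ∷ ps ,
      ( (middle-avoids h₂≉₁ , first-avoids h₁≉α ∘ trans (sym (assoc₄ _ _ _ _)))
      , last-avoids h₃≉α
      , (middle-avoids h₃≉₂ , middle-avoids h₃≉γ)
      , middle-avoids h₃≉₃ ∘ trans (sym (assoc (z₂ ∙ h₃) z₃ e))
      , (last-avoids x≉₁ , first-avoids h₃≉₄ ∘ trans (sym (assoc₄ _ _ _ _)))
      , chain ) ,
      evens ,
      prep z₁ (prep z₂ (prep z₃ (↭-trans (prep x ps₂↭) (↭-sym xs↭))))
      where
      evens : h₁ ∷ h₂ ∷ h₃ ∷ e ∷ map proj₁ ps ↭ es
      evens = ↭-trans (++-comm (h₁ ∷ h₂ ∷ h₃ ∷ []) (e ∷ map proj₁ ps))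
        (↭-trans (prep e (↭-trans (++⁺ ps₁↭ (↭-sym hs↭))
           (↭-trans (↭-reflexive (List.++-assoc gs fs hs)) (++⁺ˡ gs (↭-sym rest↭)))))
          (↭-sym es↭gs++rest))

-- Eight elements

-- The fact (x , a , y , b) asserts x a y b = 1; the even letter 0F is the identity.
Fact : Set
Fact = Fin 4 × Fin 5 × Fin 4 × Fin 5

turned : Fact → Fact
turned (x , a , y , b) = y , b , x , a

_≟ᶠ_ : Decidable {A = Fact} _≡_
(x , a , y , b) ≟ᶠ (z , c , w , d) =
  map′ (λ { (≡.refl , ≡.refl , ≡.refl , ≡.refl) → ≡.refl })
       (λ { ≡.refl → ≡.refl , ≡.refl , ≡.refl , ≡.refl })
    (x Fin.≟ z ×-dec a Fin.≟ c ×-dec y Fin.≟ w ×-dec b Fin.≟ d)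

module Short {c ℓ e} (G : Group c ℓ) (_≟_ : Decidable (Group._≈_ G))
  (Even : Group.Carrier G → Set e)
  (Even-ε : Even (Group.ε G))
  (Even-∙ : ∀ {x y} → Even x → Even y → Even (Group._∙_ G x y))
  (Even-⁻¹ : ∀ {x} → Even x → Even (Group._⁻¹ G x))
  (no-involution : ∀ {x} → Even x → Group._≈_ G (Group._∙_ G x x) (Group.ε G) →
                   Group._≈_ G x (Group.ε G))
  (es xs : List (Group.Carrier G))
  where
  open Group G
  open GroupProperties G
  open UniqueSetoid setoid using (Unique)
  open Words G
  open Pool G _≟_
  open Long G _≟_ using (Arrangement; assoc₄)

  record Labelling : Set c where
    field
      evens odds : Vec Carrier 4
      evens↭     : toList evens ↭ es
      odds↭      : toList odds ↭ xs

    even : Fin 5 → Carrier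
    even = lookup (ε ∷ evens)

    odd : Fin 4 → Carrier
    odd = lookup odds

  open Labelling

  infix 4 _⊨_
  _⊨_ : Labelling → Fact → Set ℓ
  L ⊨ (x , a , y , b) = odd L x ∙ even L a ∙ odd L y ∙ even L b ≈ ε

  _⊨?_ : Decidable _⊨_
  L ⊨? (x , a , y , b) = (odd L x ∙ even L a ∙ odd L y ∙ even L b) ≟ ε

  -- The conclusion is an arrangement, not a contradiction, which keeps the argument constructive.
  -- Quantifying over `L` allows a proved sequent to be used under any relabelling.
  Sequent : List Fact → List Fact → Set _
  Sequent pos neg = ∀ L → All (L ⊨_) pos → All (¬_ ∘ (L ⊨_)) neg → Arrangement es xs

  Claim : List Fact → Set _
  Claim pos = Sequent pos []

  turn : ∀ L f → L ⊨ turned f → L ⊨ f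
  turn L (x , a , y , b) holds =
    trans (assoc _ _ _) (rotate (trans (sym (assoc _ _ _)) holds))

  -- Stated through sorting, this is decided by evaluation, and the sorting algorithm supplies the
  -- permutation.
  IsPermutation : ∀ {n} → List (Fin n) → List (Fin n) → Set
  IsPermutation {n} ls is = sort ls ≡ is
    where open InsertionSort (Fin.≤-decTotalOrder n)

  isPermutation? : ∀ {n} (ls is : List (Fin n)) → Dec (IsPermutation ls is)
  isPermutation? ls is = List.≡-dec Fin._≟_ _ is

  record Renaming : Set where
    field
      evenNames : Vec (Fin 5) 4
      oddNames  : Vec (Fin 4) 4
      evenPerm  : IsPermutation (toList evenNames) (1F ∷ 2F ∷ 3F ∷ 4F ∷ [])
      oddPerm   : IsPermutation (toList oddNames) (0F ∷ 1F ∷ 2F ∷ 3F ∷ [])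

    rename : Fact → Fact
    rename (x , a , y , b) =
      lookup oddNames x , lookup (0F ∷ evenNames) a ,
      lookup oddNames y , lookup (0F ∷ evenNames) b

  open Renaming

  renaming? : Vec (Fin 5) 4 → Vec (Fin 4) 4 → Maybe Renaming
  renaming? p q = Maybe.zipWith
    (λ evenPerm oddPerm → record
      { evenNames = p ; oddNames = q ; evenPerm = evenPerm ; oddPerm = oddPerm })
    (dec⇒maybe (isPermutation? (toList p) _)) (dec⇒maybe (isPermutation? (toList q) _))

  relabel : Renaming → Labelling → Labelling
  relabel R L = record
    { evens  = Vec.map (even L) (evenNames R)
    ; odds   = Vec.map (odd L) (oddNames R)
    ; evens↭ = ↭-trans (permuted (even L) (evenNames R) (evenPerm R))
                 (↭-trans (↭-reflexive (all-evens (evens L))) (evens↭ L))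
    ; odds↭  = ↭-trans (permuted (odd L) (oddNames R) (oddPerm R))
                 (↭-trans (↭-reflexive (all-odds (odds L))) (odds↭ L))
    }
    where
    permuted : ∀ {n is} (f : Fin n → Carrier) (p : Vec (Fin n) 4) → IsPermutation (toList p) is →
               toList (Vec.map f p) ↭ map f is
    permuted {n} f p ≡.refl = ↭-trans (↭-reflexive (toList-map f p))
      (↭-map⁺ f (↭-sym (SortingAlgorithm.sort-↭ insertionSort (toList p))))
      where open InsertionSort (Fin.≤-decTotalOrder n)

    all-evens : ∀ v → map (lookup (ε ∷ v)) (1F ∷ 2F ∷ 3F ∷ 4F ∷ []) ≡ toList v
    all-evens (_ ∷ _ ∷ _ ∷ _ ∷ []) = ≡.refl

    all-odds : ∀ v → map (lookup v) (0F ∷ 1F ∷ 2F ∷ 3F ∷ []) ≡ toList v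
    all-odds (_ ∷ _ ∷ _ ∷ _ ∷ []) = ≡.refl

  -- Renaming the letters of a fact amounts to changing the labelling; thus a claim for one choice
  -- of letters covers all choices.
  relabel-≡ : ∀ R L f → (relabel R L ⊨ f) ≡ (L ⊨ rename R f)
  relabel-≡ R L (x , a , y , b)
    rewrite lookup-map x (odd L) (oddNames R) | lookup-map y (odd L) (oddNames R)
          | lookup-map a (even L) (0F ∷ evenNames R) | lookup-map b (even L) (0F ∷ evenNames R)
    = ≡.refl

  relabel⁺ : ∀ R L f → L ⊨ rename R f → relabel R L ⊨ f
  relabel⁺ R L f = ≡.subst (λ A → A) (≡.sym (relabel-≡ R L f))

  relabel⁻ : ∀ R L f → relabel R L ⊨ f → L ⊨ rename R f
  relabel⁻ R L f = ≡.subst (λ A → A) (relabel-≡ R L f)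

  -- The equations that make the word 1F 0F 2F 1F 3F 2F 4F 3F invalid.
  obstructions : List Fact
  obstructions =
    (0F , 2F , 1F , 0F) ∷ (0F , 2F , 1F , 1F) ∷ (0F , 2F , 1F , 3F) ∷
    (1F , 3F , 2F , 0F) ∷ (1F , 3F , 2F , 2F) ∷ (1F , 3F , 2F , 4F) ∷
    (2F , 4F , 3F , 0F) ∷ (2F , 4F , 3F , 3F) ∷ []

  unobstructed : ∀ L → All (¬_ ∘ (L ⊨_)) obstructions → Arrangement es xs
  unobstructed record { evens = h₁ ∷ h₂ ∷ h₃ ∷ h₄ ∷ [] ; odds = x₁ ∷ x₂ ∷ x₃ ∷ x₄ ∷ []
                      ; evens↭ = evens↭ ; odds↭ = odds↭ }
    (n₁ ∷ n₂ ∷ n₃ ∷ n₄ ∷ n₅ ∷ n₆ ∷ n₇ ∷ n₈ ∷ []) =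
    (h₁ , x₁) ∷ (h₂ , x₂) ∷ (h₃ , x₃) ∷ (h₄ , x₄) ∷ [] ,
    ( (n₁ ∘ trans (identityʳ _) , n₂ ∘ turned₄) , n₃
    , (n₄ ∘ trans (identityʳ _) , n₅ ∘ turned₄) , n₆
    , (n₇ ∘ trans (identityʳ _) , n₈ ∘ turned₄) , tt ) ,
    evens↭ , odds↭
    where
    turned₄ : ∀ {h x k y} → h ∙ x ∙ k ∙ y ≈ ε → x ∙ k ∙ y ∙ h ≈ ε
    turned₄ holds = rotate (trans (sym (assoc₄ _ _ _ _)) holds)

  -- Multiplication by a b⁻¹ swaps x and y.
  twistʳ-≈ : ∀ {x y a b} → Even a → Even b → x ∙ a ≈ y ∙ b → x ∙ b ≈ y ∙ a → a ≈ b
  twistʳ-≈ {x} {y} {a} {b} even-a even-b xa≈yb xb≈ya =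
    trans (inverseˡ-unique a (b ⁻¹) (no-involution (Even-∙ even-a (Even-⁻¹ even-b)) r²≈ε))
          (⁻¹-involutive b)
    where
    r = a ∙ b ⁻¹

    cancelled : ∀ {u v} → u ∙ a ≈ v ∙ b → u ∙ r ≈ v
    cancelled {u} {v} ua≈vb = trans (sym (assoc u a (b ⁻¹)))
      (trans (∙-congʳ ua≈vb) (trans (assoc v b (b ⁻¹)) (trans (∙-congˡ (inverseʳ b)) (identityʳ v))))

    r²≈ε : r ∙ r ≈ ε
    r²≈ε = identityʳ-unique x (r ∙ r)
      (trans (sym (assoc x r r)) (trans (∙-congʳ (cancelled xa≈yb)) (cancelled (sym xb≈ya))))

  -- The mirror image: left multiplication by `b⁻¹ a` swaps `x` and `y`.
  twistˡ-≈ : ∀ {x y a b} → Even a → Even b → a ∙ x ≈ b ∙ y → a ∙ y ≈ b ∙ x → a ≈ b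
  twistˡ-≈ {x} {y} {a} {b} even-a even-b ax≈by ay≈bx =
    trans (inverseʳ-unique (b ⁻¹) a (no-involution (Even-∙ (Even-⁻¹ even-b) even-a) r²≈ε))
          (⁻¹-involutive b)
    where
    r = b ⁻¹ ∙ a

    cancelled : ∀ {u v} → a ∙ u ≈ b ∙ v → r ∙ u ≈ v
    cancelled {u} {v} au≈bv = trans (assoc (b ⁻¹) a u)
      (trans (∙-congˡ au≈bv) (trans (sym (assoc (b ⁻¹) b v)) (trans (∙-congʳ (inverseˡ b)) (identityˡ v))))

    r²≈ε : r ∙ r ≈ ε
    r²≈ε = identityˡ-unique (r ∙ r) x
      (trans (assoc r r x) (trans (∙-congˡ (cancelled ax≈by)) (cancelled ay≈bx)))

  module _ (unique : Unique (ε ∷ es)) (uniqueₒ : Unique xs) (all-even : All Even es) where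

    lookup-fresh : ∀ {n x} (v : Vec Carrier n) → All (x ≉_) (toList v) → ∀ i → x ≉ lookup v i
    lookup-fresh (y ∷ v) (x≉y ∷ _) zero    = x≉y
    lookup-fresh (y ∷ v) (_ ∷ x∉)  (suc i) = lookup-fresh v x∉ i

    lookup-injective : ∀ {n} (v : Vec Carrier n) → Unique (toList v) →
                       ∀ {i j} → lookup v i ≈ lookup v j → i ≡ j
    lookup-injective (x ∷ v) _        {zero}  {zero}  _  = ≡.refl
    lookup-injective (x ∷ v) (x∉ ∷ _) {zero}  {suc j} eq = ⊥-elim (lookup-fresh v x∉ j eq)
    lookup-injective (x ∷ v) (x∉ ∷ _) {suc i} {zero}  eq = ⊥-elim (lookup-fresh v x∉ i (sym eq))
    lookup-injective (x ∷ v) (_ ∷ u)  {suc i} {suc j} eq = ≡.cong suc (lookup-injective v u eq)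

    odd-injective : ∀ L {x y} → odd L x ≈ odd L y → x ≡ y
    odd-injective L = lookup-injective (odds L) (Unique-resp-↭ (↭-sym (odds↭ L)) uniqueₒ)

    even-injective : ∀ L {a b} → even L a ≈ even L b → a ≡ b
    even-injective L =
      lookup-injective (ε ∷ evens L) (Unique-resp-↭ (prep ε (↭-sym (evens↭ L))) unique)

    even-Even : ∀ L a → Even (even L a)
    even-Even L = lookup-All (ε ∷ evens L) (Even-ε ∷ All-resp-↭ (↭-sym (evens↭ L)) all-even)
      where
      lookup-All : ∀ {n} (v : Vec Carrier n) → All Even (toList v) → ∀ i → Even (lookup v i)
      lookup-All (_ ∷ v) (p ∷ _)  zero    = p
      lookup-All (_ ∷ v) (_ ∷ ps) (suc i) = lookup-All v ps i

    -- By cancellation an equation determines each letter from the other three, so facts that differ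
    -- in exactly one position exclude each other. In all other cases `nothing` only means that this
    -- test gives no information.
    clash : ∀ f g → Maybe (∀ L → L ⊨ f → ¬ L ⊨ g)
    clash (x , a , y , b) (z , c , w , d)
      with x Fin.≟ z | a Fin.≟ c | y Fin.≟ w | b Fin.≟ d
    ... | no x≢z | yes ≡.refl | yes ≡.refl | yes ≡.refl = just λ L f g → x≢z (odd-injective L
      (∙-cancelʳ _ _ _ (∙-cancelʳ _ _ _ (∙-cancelʳ _ _ _ (trans f (sym g))))))
    ... | yes ≡.refl | no a≢c | yes ≡.refl | yes ≡.refl = just λ L f g → a≢c (even-injective L
      (∙-cancelˡ _ _ _ (∙-cancelʳ _ _ _ (∙-cancelʳ _ _ _ (trans f (sym g))))))
    ... | yes ≡.refl | yes ≡.refl | no y≢w | yes ≡.refl = just λ L f g → y≢w (odd-injective L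
      (∙-cancelˡ _ _ _ (∙-cancelʳ _ _ _ (trans f (sym g)))))
    ... | yes ≡.refl | yes ≡.refl | yes ≡.refl | no b≢d = just λ L f g → b≢d (even-injective L
      (∙-cancelˡ _ _ _ (trans f (sym g))))
    ... | _ | _ | _ | _ = nothing

    -- A word proves a sequent if all its obstructions are excluded.  From x a z c, x a w d and
    -- y b z c, rectʳ (x a z c) (y b w d) infers y b w d, which has to be excluded.  From x a z c,
    -- y b z c, x b w d and y a w d, twistʳ (x a z c) (y b w d) infers a = b.  The variants ˡ do
    -- the same with the blocks a x and b y in place of x a and y b.
    data Certificate : Set (c ⊔ ℓ) where
      split : Fact → Certificate → Certificate → Certificate
      word  : Fin 5 → Fin 4 → Fin 5 → Fin 4 → Fin 5 → Fin 4 → Fin 5 → Fin 4 → Certificate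
      lemma : ∀ {pos} → Claim pos → Fin 5 → Fin 5 → Fin 5 → Fin 5 →
              Fin 4 → Fin 4 → Fin 4 → Fin 4 → Certificate
      rectʳ rectˡ twistʳ twistˡ : (f g : Fact) → Certificate

    -- Checking of certificates, relative to equations settled before.

    module _ (given : ∀ f → Maybe (Claim (f ∷ []))) where

      Known : List Fact → Fact → Set _
      Known pos f = ∀ L → All (L ⊨_) pos → L ⊨ f

      known : ∀ pos f → Maybe (Known pos f)
      known pos f =
        Maybe.map (λ f∈ L ps → All.lookup ps f∈) (dec⇒maybe (any? (f ≟ᶠ_) pos)) <∣>
        Maybe.map (λ f∈ L ps → turn L f (All.lookup ps f∈)) (dec⇒maybe (any? (turned f ≟ᶠ_) pos))

      knownAll : ∀ pos fs → Maybe (All (Known pos) fs)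
      knownAll pos []       = just []
      knownAll pos (f ∷ fs) = Maybe.zipWith _∷_ (known pos f) (knownAll pos fs)

      clashes : ∀ pos f → Maybe (∀ L → All (L ⊨_) pos → ¬ L ⊨ f)
      clashes []        f = nothing
      clashes (g ∷ pos) f =
        Maybe.map (λ { cl L (h ∷ _) → cl L h }) (clash g f) <∣>
        Maybe.map (λ { cl L (h ∷ _) → cl L h ∘ turn L (turned f) }) (clash g (turned f)) <∣>
        Maybe.map (λ { cl L (_ ∷ hs) → cl L hs }) (clashes pos f)

      -- Three sources, each up to turning the fact: it was excluded on this branch, it clashes with
      -- a known fact, or an earlier claim already turns it into an arrangement.
      refute : ∀ pos neg f → Maybe (Sequent (f ∷ pos) neg)
      refute pos neg f =
        Maybe.map (λ { f∈ L (h ∷ _) ns → ⊥-elim (All.lookup ns f∈ h) })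
          (dec⇒maybe (any? (f ≟ᶠ_) neg)) <∣>
        Maybe.map (λ { f∈ L (h ∷ _) ns → ⊥-elim (All.lookup ns f∈ (turn L (turned f) h)) })
          (dec⇒maybe (any? (turned f ≟ᶠ_) neg)) <∣>
        Maybe.map (λ { cl L (h ∷ hs) _ → ⊥-elim (cl L hs h) }) (clashes pos f) <∣>
        Maybe.map (λ { claim L (h ∷ _) _ → claim L (h ∷ []) [] }) (given f) <∣>
        Maybe.map (λ { claim L (h ∷ _) _ → claim L (turn L (turned f) h ∷ []) [] }) (given (turned f))

      refuteAll : ∀ pos neg fs → Maybe (All (λ f → Sequent (f ∷ pos) neg) fs)
      refuteAll pos neg []       = just []
      refuteAll pos neg (f ∷ fs) = Maybe.zipWith _∷_ (refute pos neg f) (refuteAll pos neg fs)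

      -- Equality is decidable: the first equation found to hold is settled by its own sequent, and
      -- if none holds, `conclude` applies to the relabelled letters.
      none-hold : ∀ {pos neg} R fs → All (λ f → Sequent (f ∷ pos) neg) (map (rename R) fs) →
        (∀ L → All (¬_ ∘ (L ⊨_)) fs → Arrangement es xs) → Sequent pos neg
      none-hold R fs refuted conclude L ps ns = go fs refuted (conclude (relabel R L))
        where
        go : ∀ fs → All (λ f → Sequent (f ∷ _) _) (map (rename R) fs) →
          (All (¬_ ∘ (relabel R L ⊨_)) fs → Arrangement es xs) → Arrangement es xs
        go []       []       k = k []
        go (f ∷ fs) (r ∷ rs) k with L ⊨? rename R f
        ... | yes h = r L (h ∷ ps) ns
        ... | no ¬h = go fs rs (k ∘ (¬h ∘ relabel⁻ R L f ∷_))

      -- The result is itself a proof of the sequent, so nothing rests on how a certificate was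
      -- found. A wrong certificate evaluates to `nothing`, and `from-just` then does not have the
      -- type of the claim.
      check : ∀ pos neg → Certificate → Maybe (Sequent pos neg)
      check pos neg (split f s t) =
        Maybe.zipWith cases (check (f ∷ pos) neg s) (check pos (f ∷ neg) t)
        where
        cases : Sequent (f ∷ pos) neg → Sequent pos (f ∷ neg) → Sequent pos neg
        cases s t L ps ns with L ⊨? f
        ... | yes h = s L (h ∷ ps) ns
        ... | no ¬h = t L ps (¬h ∷ ns)
      check pos neg (word h₁ x₁ h₂ x₂ h₃ x₃ h₄ x₄) =
        renaming? (h₁ ∷ h₂ ∷ h₃ ∷ h₄ ∷ []) (x₁ ∷ x₂ ∷ x₃ ∷ x₄ ∷ []) Maybe.>>= λ R →
        Maybe.map (λ refuted → none-hold R obstructions refuted unobstructed)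
          (refuteAll pos neg (map (rename R) obstructions))
      check pos neg (lemma {fs} claim h₁ h₂ h₃ h₄ x₁ x₂ x₃ x₄) =
        renaming? (h₁ ∷ h₂ ∷ h₃ ∷ h₄ ∷ []) (x₁ ∷ x₂ ∷ x₃ ∷ x₄ ∷ []) Maybe.>>= λ R →
        Maybe.map (λ ks L ps _ → claim (relabel R L) (holds R fs ks L ps) [])
          (knownAll pos (map (rename R) fs))
        where
        holds : ∀ R fs → All (Known pos) (map (rename R) fs) →
                ∀ L → All (L ⊨_) pos → All (relabel R L ⊨_) fs
        holds R []       []       L ps = []
        holds R (f ∷ fs) (k ∷ ks) L ps = relabel⁺ R L f (k L ps) ∷ holds R fs ks L ps
      check pos neg (rectʳ (x , a , z , c) (y , b , w , d)) =
        Maybe.zipWith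
          (λ where
            (k₁ ∷ k₂ ∷ k₃ ∷ []) refuted L ps ns →
              refuted L (rectʳ-holds L (k₁ L ps) (k₂ L ps) (k₃ L ps) ∷ ps) ns)
          (knownAll pos ((x , a , z , c) ∷ (x , a , w , d) ∷ (y , b , z , c) ∷ []))
          (refute pos neg (y , b , w , d))
        where
        rectʳ-holds : ∀ L → L ⊨ (x , a , z , c) → L ⊨ (x , a , w , d) → L ⊨ (y , b , z , c) →
                      L ⊨ (y , b , w , d)
        rectʳ-holds L xazc xawd ybzc = trans (∙-congʳ (∙-congʳ (sym xa≈yb))) xawd
          where
          xa≈yb : odd L x ∙ even L a ≈ odd L y ∙ even L b
          xa≈yb = ∙-cancelʳ _ _ _ (∙-cancelʳ _ _ _ (trans xazc (sym ybzc)))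
      check pos neg (rectˡ (z , a , x , c) (w , b , y , d)) =
        Maybe.zipWith
          (λ where
            (k₁ ∷ k₂ ∷ k₃ ∷ []) refuted L ps ns →
              refuted L (rectˡ-holds L (k₁ L ps) (k₂ L ps) (k₃ L ps) ∷ ps) ns)
          (knownAll pos ((z , a , x , c) ∷ (w , a , x , d) ∷ (z , b , y , c) ∷ []))
          (refute pos neg (w , b , y , d))
        where
        rectˡ-holds : ∀ L → L ⊨ (z , a , x , c) → L ⊨ (w , a , x , d) → L ⊨ (z , b , y , c) →
                      L ⊨ (w , b , y , d)
        rectˡ-holds L zaxc waxd zbyc =
          trans (∙-congʳ (trans (assoc _ _ _) (trans (∙-congˡ (sym ax≈by)) (sym (assoc _ _ _))))) waxd
          where
          ax≈by : even L a ∙ odd L x ≈ even L b ∙ odd L y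
          ax≈by = ∙-cancelˡ _ _ _ (trans (sym (assoc _ _ _))
            (trans (∙-cancelʳ _ _ _ (trans zaxc (sym zbyc))) (assoc _ _ _)))
      check pos neg (twistʳ (x , a , z , c) (y , b , w , d)) with a Fin.≟ b
      ... | yes _ = nothing
      ... | no a≢b = Maybe.map
        (λ where
          (k₁ ∷ k₂ ∷ k₃ ∷ k₄ ∷ []) L ps ns →
            ⊥-elim (a≢b (even-injective L (twistʳ-holds L (k₁ L ps) (k₂ L ps) (k₃ L ps) (k₄ L ps)))))
        (knownAll pos ((x , a , z , c) ∷ (y , b , z , c) ∷ (x , b , w , d) ∷ (y , a , w , d) ∷ []))
        where
        twistʳ-holds : ∀ L → L ⊨ (x , a , z , c) → L ⊨ (y , b , z , c) →
                       L ⊨ (x , b , w , d) → L ⊨ (y , a , w , d) → even L a ≈ even L b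
        twistʳ-holds L xazc ybzc xbwd yawd = twistʳ-≈ (even-Even L a) (even-Even L b)
          (∙-cancelʳ _ _ _ (∙-cancelʳ _ _ _ (trans xazc (sym ybzc))))
          (∙-cancelʳ _ _ _ (∙-cancelʳ _ _ _ (trans xbwd (sym yawd))))
      check pos neg (twistˡ (z , a , x , c) (w , b , y , d)) with a Fin.≟ b
      ... | yes _ = nothing
      ... | no a≢b = Maybe.map
        (λ where
          (k₁ ∷ k₂ ∷ k₃ ∷ k₄ ∷ []) L ps ns →
            ⊥-elim (a≢b (even-injective L (twistˡ-holds L (k₁ L ps) (k₂ L ps) (k₃ L ps) (k₄ L ps)))))
        (knownAll pos ((z , a , x , c) ∷ (z , b , y , c) ∷ (w , a , y , d) ∷ (w , b , x , d) ∷ []))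
        where
        twistˡ-holds : ∀ L → L ⊨ (z , a , x , c) → L ⊨ (z , b , y , c) →
                       L ⊨ (w , a , y , d) → L ⊨ (w , b , x , d) → even L a ≈ even L b
        twistˡ-holds L zaxc zbyc wayd wbxd = twistˡ-≈ (even-Even L a) (even-Even L b)
          (∙-cancelˡ _ _ _ (trans (sym (assoc _ _ _))
            (trans (∙-cancelʳ _ _ _ (trans zaxc (sym zbyc))) (assoc _ _ _))))
          (∙-cancelˡ _ _ _ (trans (sym (assoc _ _ _))
            (trans (∙-cancelʳ _ _ _ (trans wayd (sym wbxd))) (assoc _ _ _))))

    -- A split with its branches exchanged: `t` settles the case that `f` fails, and the main line
    -- of the certificate continues with `f` as a known fact.
    derive : Fact → Certificate → Certificate → Certificate
    derive f t s = split f s t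

    -- The certificates were found by a computer search.
    triple-square-disjoint : Claim ((0F , 1F , 1F , 0F) ∷ (2F , 2F , 3F , 3F) ∷ [])
    triple-square-disjoint = Maybe.from-just (check (λ _ → nothing)
      ((0F , 1F , 1F , 0F) ∷ (2F , 2F , 3F , 3F) ∷ []) [] $
      split (1F , 2F , 3F , 1F)
        (derive (0F , 3F , 2F , 0F) (rectˡ (1F , 2F , 3F , 1F) (2F , 0F , 0F , 3F)) $
         split (1F , 3F , 2F , 1F)
           (derive (0F , 0F , 0F , 0F) (rectˡ (1F , 3F , 2F , 1F) (0F , 0F , 0F , 0F)) $
            derive (0F , 2F , 3F , 0F) (rectˡ (1F , 0F , 0F , 1F) (0F , 2F , 3F , 0F)) $
            split (0F , 3F , 1F , 4F)
              (derive (0F , 2F , 2F , 4F) (word 3F 3F 1F 1F 4F 0F 2F 2F) $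
               derive (0F , 1F , 3F , 4F) (word 2F 1F 3F 2F 4F 0F 1F 3F) $
               derive (1F , 0F , 2F , 4F) (word 2F 0F 1F 3F 3F 2F 4F 1F) $
               derive (2F , 0F , 3F , 4F) (word 1F 0F 3F 1F 2F 3F 4F 2F) $
               rectʳ (3F , 4F , 0F , 1F) (1F , 0F , 2F , 0F)) $
            split (0F , 3F , 3F , 4F)
              (derive (0F , 1F , 2F , 4F) (word 3F 1F 2F 3F 4F 0F 1F 2F) $
               derive (0F , 2F , 1F , 4F) (word 1F 3F 3F 2F 4F 0F 2F 1F) $
               derive (2F , 4F , 3F , 0F) (word 1F 0F 2F 1F 3F 2F 4F 3F) $
               derive (1F , 0F , 3F , 4F) (word 3F 0F 1F 2F 2F 3F 4F 1F) $
               rectʳ (2F , 4F , 0F , 1F) (1F , 0F , 3F , 0F)) $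
            derive (0F , 0F , 1F , 4F) (word 2F 2F 1F 1F 4F 0F 3F 3F) $
            word 1F 2F 2F 3F 4F 0F 3F 1F) $
         derive (0F , 0F , 1F , 2F) (word 4F 3F 3F 2F 1F 1F 2F 0F) $
         word 4F 3F 1F 1F 3F 2F 2F 0F) $
      split (1F , 3F , 3F , 1F)
        (split (0F , 0F , 1F , 2F)
           (split (0F , 3F , 1F , 4F)
              (split (1F , 2F , 3F , 4F)
                 (split (0F , 1F , 3F , 4F) (rectʳ (3F , 4F , 0F , 1F) (1F , 0F , 1F , 2F)) $
                  derive (0F , 1F , 3F , 3F) (word 2F 1F 4F 0F 1F 3F 3F 2F) $
                  derive (0F , 1F , 2F , 2F) (word 3F 2F 2F 0F 1F 3F 4F 1F) $
                  derive (2F , 3F , 3F , 0F) (word 2F 1F 4F 0F 1F 2F 3F 3F) $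
                  derive (0F , 0F , 3F , 4F) (word 2F 1F 3F 3F 4F 0F 1F 2F) $
                  derive (0F , 2F , 3F , 1F) (word 4F 2F 2F 3F 1F 0F 3F 1F) $
                  word 2F 1F 1F 0F 3F 3F 4F 2F) $
               derive (2F , 0F , 3F , 4F) (word 1F 0F 3F 1F 2F 3F 4F 2F) $
               derive (0F , 4F , 1F , 3F) (word 3F 0F 4F 1F 2F 3F 1F 2F) $
               derive (0F , 0F , 3F , 3F) (word 1F 1F 2F 3F 3F 0F 4F 2F) $
               derive (0F , 2F , 3F , 1F) (word 4F 2F 2F 3F 1F 0F 3F 1F) $
               derive (0F , 4F , 3F , 0F) (word 2F 1F 1F 0F 4F 3F 3F 2F) $
               derive (1F , 3F , 2F , 0F) (word 1F 0F 2F 1F 3F 2F 4F 3F) $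
               word 1F 1F 2F 3F 4F 0F 3F 2F) $
            derive (2F , 0F , 3F , 1F) (word 4F 0F 3F 1F 2F 3F 1F 2F) $
            split (0F , 3F , 1F , 1F)
              (split (0F , 4F , 1F , 3F)
                 (derive (2F , 3F , 3F , 4F) (word 1F 0F 2F 1F 3F 3F 4F 2F) $
                  derive (1F , 1F , 2F , 4F) (word 2F 0F 4F 1F 1F 2F 3F 3F) $
                  derive (0F , 4F , 3F , 1F) (word 3F 3F 1F 0F 4F 1F 2F 2F) $
                  word 2F 0F 4F 3F 3F 2F 1F 1F) $
               derive (2F , 3F , 3F , 2F) (word 1F 0F 4F 1F 3F 3F 2F 2F) $
               derive (1F , 2F , 2F , 1F) (word 4F 3F 2F 2F 1F 1F 3F 0F) $
               derive (0F , 4F , 3F , 1F) (word 3F 3F 1F 0F 4F 1F 2F 2F) $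
               word 4F 2F 3F 3F 1F 0F 2F 1F) $
            derive (0F , 2F , 3F , 1F) (word 4F 2F 2F 3F 1F 0F 3F 1F) $
            derive (0F , 2F , 1F , 3F) (word 1F 1F 3F 0F 2F 3F 4F 2F) $
            derive (1F , 4F , 2F , 1F) (word 3F 2F 1F 1F 4F 0F 2F 3F) $
            word 1F 0F 3F 1F 4F 2F 2F 3F) $
         derive (1F , 2F , 2F , 1F) (word 4F 3F 3F 2F 1F 1F 2F 0F) $
         split (0F , 3F , 2F , 0F) (rectˡ (1F , 0F , 0F , 1F) (2F , 3F , 3F , 3F)) $
         derive (0F , 3F , 1F , 2F) (word 4F 3F 1F 1F 2F 0F 3F 2F) $
         split (1F , 3F , 2F , 4F)
           (derive (0F , 0F , 1F , 4F) (word 2F 3F 1F 1F 4F 0F 3F 2F) $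
            derive (0F , 2F , 2F , 4F) (word 1F 3F 3F 2F 4F 0F 2F 1F) $
            derive (0F , 3F , 3F , 4F) (word 1F 2F 2F 3F 4F 0F 3F 1F) $
            derive (0F , 3F , 2F , 1F) (word 2F 0F 3F 2F 1F 1F 4F 3F) $
            twistʳ (2F , 4F , 1F , 3F) (3F , 1F , 0F , 3F)) $
         derive (1F , 0F , 2F , 4F) (word 1F 3F 3F 2F 4F 1F 2F 0F) $
         derive (2F , 4F , 3F , 1F) (word 3F 2F 4F 3F 1F 1F 2F 0F) $
         derive (0F , 1F , 3F , 1F) (rectʳ (2F , 4F , 1F , 0F) (0F , 1F , 3F , 1F)) $
         word 4F 1F 2F 0F 1F 3F 3F 2F) $
      derive (0F , 0F , 1F , 3F) (word 4F 2F 2F 3F 1F 1F 3F 0F) $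
      split (1F , 3F , 2F , 1F)
        (derive (1F , 2F , 3F , 0F) (word 4F 2F 1F 1F 2F 3F 3F 0F) $
         rectˡ (1F , 3F , 2F , 1F) (3F , 0F , 0F , 2F)) $
      derive (1F , 2F , 2F , 1F) (word 4F 3F 3F 2F 1F 1F 2F 0F) $
      split (1F , 4F , 3F , 1F)
        (split (0F , 4F , 3F , 3F)
           (derive (0F , 2F , 2F , 3F) (rectˡ (1F , 4F , 3F , 1F) (0F , 2F , 2F , 3F)) $
            rectˡ (1F , 2F , 2F , 1F) (0F , 0F , 0F , 3F)) $
         derive (2F , 4F , 3F , 0F) (word 1F 2F 4F 3F 3F 0F 2F 1F) $
         derive (0F , 4F , 3F , 2F) (word 2F 0F 4F 3F 3F 2F 1F 1F) $
         derive (0F , 1F , 3F , 3F) (word 4F 1F 2F 0F 1F 3F 3F 2F) $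
         derive (1F , 3F , 2F , 4F) (word 3F 2F 4F 1F 2F 0F 1F 3F) $
         twistʳ (3F , 3F , 0F , 1F) (1F , 0F , 2F , 4F)) $
      derive (0F , 0F , 2F , 2F) (word 4F 3F 1F 1F 3F 2F 2F 0F) $
      derive (1F , 3F , 3F , 3F) (rectʳ (0F , 0F , 2F , 2F) (3F , 3F , 1F , 3F)) $
      derive (0F , 3F , 1F , 2F) (word 4F 3F 3F 1F 2F 0F 1F 2F) $
      word 4F 2F 1F 1F 3F 3F 2F 0F)

    -- The triple `x a y = 1` and the square `x a y b = 1` now share the odd letter `0F` and the
    -- even letter `1F`. A branch that produces a triple and a square without common letters falls
    -- back on `triple-square-disjoint`.
    triple-square-adjacent : Claim ((0F , 1F , 1F , 0F) ∷ (0F , 2F , 2F , 1F) ∷ [])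
    triple-square-adjacent = Maybe.from-just (check (λ _ → nothing)
      ((0F , 1F , 1F , 0F) ∷ (0F , 2F , 2F , 1F) ∷ []) [] $
      split (2F , 2F , 3F , 3F) (lemma triple-square-disjoint 1F 2F 3F 4F 0F 1F 2F 3F) $
      split (2F , 2F , 3F , 4F) (lemma triple-square-disjoint 1F 2F 4F 3F 0F 1F 2F 3F) $
      split (2F , 3F , 3F , 2F) (lemma triple-square-disjoint 1F 3F 2F 4F 0F 1F 2F 3F) $
      split (2F , 4F , 3F , 2F) (lemma triple-square-disjoint 1F 4F 2F 3F 0F 1F 2F 3F) $
      split (2F , 4F , 3F , 3F) (lemma triple-square-disjoint 1F 4F 3F 2F 0F 1F 2F 3F) $
      split (1F , 0F , 3F , 3F) (lemma triple-square-disjoint 3F 2F 1F 4F 3F 1F 0F 2F) $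
      split (2F , 0F , 3F , 2F)
        (split (0F , 3F , 1F , 1F) (lemma triple-square-disjoint 2F 3F 1F 4F 3F 2F 0F 1F) $
         split (0F , 4F , 1F , 1F) (lemma triple-square-disjoint 2F 4F 1F 3F 3F 2F 0F 1F) $
         derive (2F , 1F , 3F , 3F) (word 2F 3F 3F 2F 1F 0F 4F 1F) $
         word 2F 3F 4F 2F 1F 0F 3F 1F) $
      split (1F , 4F , 2F , 1F)
        (derive (0F , 0F , 1F , 3F) (word 4F 3F 2F 2F 1F 1F 3F 0F) $
         split (2F , 2F , 3F , 1F) (lemma triple-square-disjoint 3F 2F 1F 4F 1F 0F 2F 3F) $
         split (2F , 4F , 3F , 1F) (lemma triple-square-disjoint 3F 4F 1F 2F 1F 0F 2F 3F) $
         derive (2F , 4F , 3F , 0F) (word 3F 0F 2F 2F 4F 3F 1F 1F) $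
         split (0F , 3F , 1F , 1F) (lemma triple-square-disjoint 4F 3F 1F 2F 2F 3F 0F 1F) $
         derive (2F , 0F , 3F , 4F) (word 2F 3F 4F 2F 1F 0F 3F 1F) $
         derive (2F , 1F , 3F , 3F) (word 4F 3F 3F 2F 1F 1F 2F 0F) $
         derive (1F , 2F , 3F , 3F) (word 4F 2F 2F 3F 3F 1F 1F 0F) $
         word 3F 2F 2F 3F 1F 1F 4F 0F) $
      derive (0F , 0F , 1F , 4F) (word 3F 3F 2F 2F 1F 1F 4F 0F) $
      split (2F , 1F , 3F , 3F) (lemma triple-square-disjoint 4F 1F 3F 2F 1F 0F 2F 3F) $
      split (2F , 3F , 3F , 1F) (lemma triple-square-disjoint 4F 3F 1F 2F 1F 0F 2F 3F) $
      derive (0F , 3F , 2F , 4F) (word 1F 3F 2F 2F 4F 0F 3F 1F) $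
      derive (1F , 3F , 2F , 1F) (word 4F 3F 2F 2F 1F 1F 3F 0F) $
      derive (2F , 3F , 3F , 0F) (word 4F 0F 2F 2F 3F 3F 1F 1F) $
      split (0F , 4F , 1F , 1F) (lemma triple-square-disjoint 3F 4F 1F 2F 2F 3F 0F 1F) $
      split (0F , 4F , 1F , 2F) (lemma triple-square-disjoint 3F 4F 2F 1F 2F 3F 0F 1F) $
      derive (0F , 3F , 1F , 2F) (word 4F 1F 2F 0F 3F 2F 1F 3F) $
      word 4F 1F 1F 0F 3F 2F 2F 3F)

    -- The first twelve splits use the two preceding claims to exclude the six squares with distinct
    -- letters disjoint from the triple, and six squares that share `0F` and `1F` with it.
    triple : Claim ((0F , 1F , 1F , 0F) ∷ [])
    triple = Maybe.from-just (check (λ _ → nothing)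
      ((0F , 1F , 1F , 0F) ∷ []) [] $
      split (2F , 2F , 3F , 3F) (lemma triple-square-disjoint 1F 2F 3F 4F 0F 1F 2F 3F) $
      split (2F , 2F , 3F , 4F) (lemma triple-square-disjoint 1F 2F 4F 3F 0F 1F 2F 3F) $
      split (2F , 3F , 3F , 2F) (lemma triple-square-disjoint 1F 3F 2F 4F 0F 1F 2F 3F) $
      split (2F , 3F , 3F , 4F) (lemma triple-square-disjoint 1F 3F 4F 2F 0F 1F 2F 3F) $
      split (2F , 4F , 3F , 2F) (lemma triple-square-disjoint 1F 4F 2F 3F 0F 1F 2F 3F) $
      split (2F , 4F , 3F , 3F) (lemma triple-square-disjoint 1F 4F 3F 2F 0F 1F 2F 3F) $
      split (0F , 2F , 2F , 1F) (lemma triple-square-adjacent 1F 2F 3F 4F 0F 1F 2F 3F) $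
      split (0F , 2F , 3F , 1F) (lemma triple-square-adjacent 1F 2F 3F 4F 0F 1F 3F 2F) $
      split (0F , 3F , 2F , 1F) (lemma triple-square-adjacent 1F 3F 2F 4F 0F 1F 2F 3F) $
      split (0F , 3F , 3F , 1F) (lemma triple-square-adjacent 1F 3F 2F 4F 0F 1F 3F 2F) $
      split (0F , 4F , 2F , 1F) (lemma triple-square-adjacent 1F 4F 2F 3F 0F 1F 2F 3F) $
      split (0F , 4F , 3F , 1F) (lemma triple-square-adjacent 1F 4F 2F 3F 0F 1F 3F 2F) $
      split (0F , 0F , 3F , 1F)
        (split (2F , 1F , 3F , 3F) (lemma triple-square-adjacent 1F 3F 2F 4F 3F 0F 2F 1F) $
         split (2F , 1F , 3F , 4F) (lemma triple-square-adjacent 1F 4F 2F 3F 3F 0F 2F 1F) $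
         split (2F , 0F , 3F , 3F)
           (derive (0F , 2F , 1F , 1F) (word 3F 3F 4F 2F 1F 0F 2F 1F) $
            lemma triple-square-disjoint 3F 2F 1F 4F 3F 2F 0F 1F) $
         derive (0F , 2F , 1F , 1F) (word 4F 3F 3F 2F 1F 0F 2F 1F) $
         word 2F 3F 3F 2F 1F 0F 4F 1F) $
      split (2F , 2F , 3F , 0F)
        (split (0F , 3F , 1F , 1F) (lemma triple-square-disjoint 2F 3F 1F 4F 2F 3F 0F 1F) $
         split (0F , 4F , 1F , 1F) (lemma triple-square-disjoint 2F 4F 1F 3F 2F 3F 0F 1F) $
         derive (2F , 3F , 3F , 1F) (word 2F 2F 3F 3F 1F 0F 4F 1F) $
         word 2F 2F 4F 3F 1F 0F 3F 1F) $
      split (2F , 2F , 3F , 1F)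
        (split (2F , 4F , 3F , 0F)
           (derive (0F , 2F , 1F , 1F) (word 4F 2F 3F 3F 1F 0F 2F 1F) $
            lemma triple-square-disjoint 4F 2F 1F 3F 2F 3F 0F 1F) $
         derive (0F , 2F , 1F , 1F) (word 3F 2F 4F 3F 1F 0F 2F 1F) $
         word 2F 2F 4F 3F 1F 0F 3F 1F) $
      derive (0F , 3F , 1F , 1F) (word 4F 2F 2F 3F 1F 0F 3F 1F) $
      word 3F 2F 2F 3F 1F 0F 4F 1F)

    renamed : ∀ {f} → Claim (f ∷ []) → Vec (Fin 5) 4 → Vec (Fin 4) 4 → ∀ g → Maybe (Claim (g ∷ []))
    renamed {f} claim p q g = renaming? p q Maybe.>>= λ R → Maybe.map
      (λ { ≡.refl L (h ∷ []) [] → claim (relabel R L) (relabel⁺ R L f h ∷ []) [] })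
      (dec⇒maybe (rename R f ≟ᶠ g))

    -- `punchOut x≢y` is the position of `y` among the indices other than `x`; the two positions
    -- that skip it, lifted past `x`, give the remaining indices.
    enumerate : ∀ {x y : Fin 4} → x ≢ y → Vec (Fin 4) 4
    enumerate {x} {y} x≢y =
      x ∷ y ∷ punchIn x (punchIn (punchOut x≢y) 0F) ∷ punchIn x (punchIn (punchOut x≢y) 1F) ∷ []

    triples : ∀ f → Maybe (Claim (f ∷ []))
    triples f@(x , suc a , y , 0F) with x Fin.≟ y
    ... | no x≢y =
      -- A triple has only one nontrivial even letter; `punchIn a 0F` is an arbitrary second one
      -- from which to enumerate.
      renamed triple (Vec.map suc (enumerate (Fin.punchInᵢ≢i a 0F ∘ ≡.sym))) (enumerate x≢y) f
    ... | yes _  = nothing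
    triples _ = nothing

    -- With `triples` given, every equation `x a y = 1` with `x` and `y` distinct counts as
    -- excluded. The two squares share the odd letter `0F` and the even letter `2F`.
    square-square : Claim ((0F , 1F , 1F , 2F) ∷ (0F , 2F , 2F , 3F) ∷ [])
    square-square = Maybe.from-just (check triples
      ((0F , 1F , 1F , 2F) ∷ (0F , 2F , 2F , 3F) ∷ []) [] $
      split (1F , 2F , 3F , 3F)
        (derive (0F , 4F , 1F , 3F) (word 1F 2F 3F 0F 4F 1F 2F 3F) $
         derive (1F , 2F , 2F , 4F) (word 1F 0F 2F 2F 4F 1F 3F 3F) $
         derive (0F , 1F , 2F , 4F) (word 3F 3F 2F 2F 4F 0F 1F 1F) $
         derive (2F , 4F , 3F , 3F) (word 1F 2F 4F 3F 3F 0F 2F 1F) $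
         derive (2F , 1F , 3F , 2F) (word 4F 0F 2F 2F 1F 3F 3F 1F) $
         derive (0F , 1F , 3F , 3F) (word 4F 2F 3F 0F 1F 3F 2F 1F) $
         derive (0F , 1F , 0F , 1F) (rectʳ (2F , 4F , 1F , 2F) (0F , 1F , 0F , 1F)) $
         split (0F , 2F , 3F , 4F) (twistʳ (2F , 4F , 0F , 1F) (3F , 3F , 0F , 2F)) $
         derive (1F , 3F , 2F , 1F) (word 4F 0F 2F 3F 3F 2F 1F 1F) $
         twistʳ (2F , 4F , 0F , 1F) (0F , 1F , 1F , 3F)) $
      derive (1F , 4F , 3F , 3F) (word 4F 3F 3F 1F 2F 2F 1F 0F) $
      word 1F 1F 2F 3F 3F 0F 4F 2F)

    -- The seven opening splits exclude squares that overlap with the given one as in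
    -- `square-square`. One further square is then forced, after which a word has all its
    -- obstructions excluded.
    square : Claim ((0F , 1F , 1F , 2F) ∷ [])
    square = Maybe.from-just (check triples
      ((0F , 1F , 1F , 2F) ∷ []) [] $
      split (0F , 3F , 2F , 1F) (lemma square-square 3F 1F 2F 4F 0F 2F 1F 3F) $
      split (0F , 3F , 3F , 1F) (lemma square-square 3F 1F 2F 4F 0F 3F 1F 2F) $
      split (0F , 4F , 2F , 1F) (lemma square-square 4F 1F 2F 3F 0F 2F 1F 3F) $
      split (1F , 3F , 2F , 2F) (lemma square-square 3F 2F 1F 4F 1F 2F 0F 3F) $
      split (1F , 3F , 3F , 2F) (lemma square-square 3F 2F 1F 4F 1F 3F 0F 2F) $
      split (1F , 4F , 2F , 2F) (lemma square-square 4F 2F 1F 3F 1F 2F 0F 3F) $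
      split (1F , 4F , 3F , 2F) (lemma square-square 4F 2F 1F 3F 1F 3F 0F 2F) $
      derive (1F , 3F , 2F , 1F) (word 4F 3F 2F 1F 3F 2F 1F 0F) $
      word 2F 1F 4F 2F 1F 0F 3F 3F)

    squares : ∀ f → Maybe (Claim (f ∷ []))
    squares f@(x , suc a , y , suc b) with x Fin.≟ y | a Fin.≟ b
    ... | no x≢y | no a≢b = renamed square (Vec.map suc (enumerate a≢b)) (enumerate x≢y) f
    ... | _      | _      = nothing
    squares _ = nothing

    -- The letters of a word are distinct, so every obstruction is a triple or a square of the kind
    -- already settled; hence any word will do.
    any-labelling : Claim []
    any-labelling = Maybe.from-just
      (check (λ f → triples f <∣> squares f) [] [] (word 1F 0F 2F 1F 3F 2F 4F 3F))

    four : ∀ (ys : List Carrier) → length ys ≡ 4 → ∃[ v ] toList {n = 4} v ≡ ys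
    four (a ∷ b ∷ c ∷ d ∷ []) _ = a ∷ b ∷ c ∷ d ∷ [] , ≡.refl

    short : length es ≡ 4 → length xs ≡ 4 → Arrangement es xs
    short |es| |xs| with four es |es| | four xs |xs|
    ... | h , h≡ | x , x≡ = any-labelling
      (record { evens = h ; odds = x ; evens↭ = ↭-reflexive h≡ ; odds↭ = ↭-reflexive x≡ }) [] []

-- From words to sequencings

module Words⇒Sequencings {c ℓ} (G : Group c ℓ) (parity : Group.Carrier G → Parity)
  (parity-cong : ∀ {x y} → Group._≈_ G x y → parity x ≡ parity y)
  (parity-ε : parity (Group.ε G) ≡ 0ℙ)
  (parity-∙ : ∀ x y → parity (Group._∙_ G x y) ≡ parity x ℙ.+ parity y)
  where
  open Group G
  open GroupProperties G
  open Words G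

  Proper : Syllable → Set ℓ
  Proper (e , x) = e ≉ ε × parity e ≡ 0ℙ × parity x ≡ 1ℙ

  flatten : List Syllable → List Carrier
  flatten []             = []
  flatten ((e , x) ∷ ps) = e ∷ x ∷ flatten ps

  flatten-↭ : ∀ ps → flatten ps ↭ map proj₁ ps ++ map proj₂ ps
  flatten-↭ []             = ↭-refl
  flatten-↭ ((e , x) ∷ ps) =
    prep e (↭-trans (prep x (flatten-↭ ps)) (↭-sym (shift x (map proj₁ ps) (map proj₂ ps))))

  different : ∀ {e x} → parity e ≡ 0ℙ → parity x ≡ 1ℙ → parity e ≢ parity x
  different pe px pe≡px with ≡.trans (≡.sym pe) (≡.trans pe≡px px)
  ... | ()

  flatten-alternates : ∀ {ps} → All Proper ps → Linked (_≢_ on parity) (flatten ps)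
  flatten-alternates [] = []
  flatten-alternates ((_ , pe , px) ∷ []) =
    different pe px ∷ [-]
  flatten-alternates ((_ , pe , px) ∷ proper@((_ , pf , _) ∷ _)) =
    different pe px ∷ different pf px ∘ ≡.sym ∷ flatten-alternates proper

  odd≉ε : ∀ {x} → parity x ≡ 1ℙ → x ≉ ε
  odd≉ε px x≈ε with ≡.trans (≡.sym px) (≡.trans (parity-cong x≈ε) parity-ε)
  ... | ()

  parity-∙-≡ : ∀ {x y p q} → parity x ≡ p → parity y ≡ q → parity (x ∙ y) ≡ p ℙ.+ q
  parity-∙-≡ px py = ≡.trans (parity-∙ _ _) (≡.cong₂ ℙ._+_ px py)

  -- Here `n` counts the letters after `y`, so the blocks have lengths 1 to 4.
  Clean : List Carrier → Set ℓ
  Clean []       = ⊤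
  Clean (y ∷ ys) =
    (∀ n → n < 4 → n ≤ length ys → foldl _∙_ y (take n ys) ≉ ε) × Clean ys

  -- This is `Chain` without the block that reaches back to the odd letter before `a`, as is right
  -- for a suffix that starts at `a`.
  Follows : Syllable → List Syllable → Set ℓ
  Follows a []       = ⊤
  Follows a (b ∷ ps) = Step a b × Chain (proj₂ a) b ps

  Chain⇒Follows : ∀ {p a} ps → Chain p a ps → Follows a ps
  Chain⇒Follows []       _                     = tt
  Chain⇒Follows (_ ∷ ps) (_ , step , chain) = step , chain

  -- Two letters are removed at a time. A block with an odd number of odd letters is odd and so
  -- differs from the identity; the other blocks are those of `Proper`, `Step` and `Chain`.
  Follows⇒Clean : ∀ {a ps} → All Proper (a ∷ ps) → Follows a ps → Clean (flatten (a ∷ ps))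
  Follows⇒Clean {e , q} {[]} ((e≉ε , pe , pq) ∷ []) _ =
    (λ { 0 _ _ → e≉ε
       ; 1 _ _ → odd≉ε (parity-∙-≡ pe pq)
       ; (suc (suc _)) _ (s≤s ()) }) ,
    (λ { 0 _ _ → odd≉ε pq }) , tt
  Follows⇒Clean {e , q} {(f , x) ∷ ps} ((e≉ε , pe , pq) ∷ proper@((_ , pf , _) ∷ _))
    ((qfx≉ε , eqfx≉ε) , chain) =
    (λ { 0 _ _ → e≉ε
       ; 1 _ _ → odd≉ε (parity-∙-≡ pe pq)
       ; 2 _ _ → odd≉ε (parity-∙-≡ (parity-∙-≡ pe pq) pf)
       ; 3 _ _ → eqfx≉ε
       ; (suc (suc (suc (suc _)))) (s≤s (s≤s (s≤s (s≤s ())))) _ }) ,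
    (λ { 0 _ _ → odd≉ε pq
       ; 1 _ _ → odd≉ε (parity-∙-≡ pq pf)
       ; 2 _ _ → qfx≉ε
       -- This block ends with the even letter after `(f , x)`; the length bound ensures that there
       -- is one.
       ; 3 _ (s≤s (s≤s 1≤)) → turn ps chain 1≤
       ; (suc (suc (suc (suc _)))) (s≤s (s≤s (s≤s (s≤s ())))) _ }) ,
    Follows⇒Clean proper (Chain⇒Follows ps chain)
    where
    turn : ∀ ps → Chain q (f , x) ps → 1 ≤ length (flatten ps) →
           foldl _∙_ (q ∙ f ∙ x) (take 1 (flatten ps)) ≉ ε
    turn (_ ∷ ps) (qfxg≉ε , _) _ = qfxg≉ε

  Valid⇒Clean : ∀ {ps} → All Proper ps → Valid ps → Clean (flatten ps)
  Valid⇒Clean {[]}         _      _     = tt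
  Valid⇒Clean {_ ∷ []}     proper valid = Follows⇒Clean proper tt
  Valid⇒Clean {_ ∷ _ ∷ _}  proper valid = Follows⇒Clean proper valid

  foldl-∙ : ∀ a y zs → foldl _∙_ (a ∙ y) zs ≈ a ∙ foldl _∙_ y zs
  foldl-∙ a y []       = refl
  foldl-∙ a y (z ∷ zs) = trans (foldl-cong zs (assoc a y z)) (foldl-∙ a (y ∙ z) zs)
    where
    foldl-cong : ∀ {x y} zs → x ≈ y → foldl _∙_ x zs ≈ foldl _∙_ y zs
    foldl-cong []       x≈y = x≈y
    foldl-cong (z ∷ zs) x≈y = foldl-cong zs (∙-congʳ x≈y)

  -- The initial value `a` is arbitrary because the induction on `i` absorbs leading letters into
  -- it. At `i = 0` cancelling `a` leaves a block of length `d` with product 1.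
  Clean⇒≉ : ∀ a ys → Clean ys → ∀ i d → 1 ≤ d → d ≤ 4 → i + d ≤ length ys →
            foldl _∙_ a (take i ys) ≉ foldl _∙_ a (take (i + d) ys)
  Clean⇒≉ a (y ∷ ys) (clean , _) zero (suc d) _ d<4 (s≤s d≤) eq =
    clean d d<4 d≤ (identityʳ-unique a _ (trans (sym (foldl-∙ a y (take d ys))) (sym eq)))
  Clean⇒≉ a (y ∷ ys) (_ , clean) (suc i) d 1≤d d≤4 (s≤s le) =
    Clean⇒≉ (a ∙ y) ys clean i d 1≤d d≤4 le

  Clean⇒partialSum-≉ : ∀ ys → Clean ys → ∀ i j → i ≤ length ys → j ≤ length ys →
    1 ≤ ∣ i - j ∣ → ∣ i - j ∣ ≤ 4 → partialSum G ys i ≉ partialSum G ys j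
  Clean⇒partialSum-≉ ys clean i j i≤ j≤ 1≤ ≤4 = case-≤ (≤-total i j)
    where
    ordered : ∀ {i j d} → i ≤ j → j ≤ length ys → d ≡ j ∸ i → 1 ≤ d → d ≤ 4 →
              partialSum G ys i ≉ partialSum G ys j
    ordered {i} {j} i≤j j≤ ≡.refl 1≤ ≤4 =
      ≡.subst (λ j → partialSum G ys i ≉ partialSum G ys j) (m+[n∸m]≡n i≤j)
        (Clean⇒≉ ε ys clean i (j ∸ i) 1≤ ≤4 (≡.subst (_≤ length ys) (≡.sym (m+[n∸m]≡n i≤j)) j≤))

    case-≤ : i ≤ j ⊎ j ≤ i → partialSum G ys i ≉ partialSum G ys j
    case-≤ (inj₁ i≤j) = ordered i≤j j≤ (m≤n⇒∣m-n∣≡n∸m i≤j) 1≤ ≤4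
    case-≤ (inj₂ j≤i) = ordered j≤i i≤ (m≤n⇒∣n-m∣≡n∸m j≤i) 1≤ ≤4 ∘ sym

-- Groups of odd order have no involution.

fixed-point-free⇒even : ∀ {n} (f : Fin n → Fin n) → (∀ i → f (f i) ≡ i) → (∀ i → f i ≢ i) → 2 ∣ n
fixed-point-free⇒even {n} f involutive free =
  ≡.subst (2 ∣_) (List.length-tabulate {n = n} (λ i → i))
    (paired (length (allFin n)) (allFin n) ≡.refl (Unique.allFin⁺ n) λ _ → ∈-allFin _)
  where
  open UniqueSetoid (≡.setoid (Fin n)) using (Unique)

  -- Removing `i` together with `f i` from a list closed under `f` leaves a closed list. The
  -- recursion runs on the length `m`, as the shorter list is obtained only up to permutation.
  paired : ∀ m is → length is ≡ m → Unique is → (∀ {i} → i ∈ is → f i ∈ is) → 2 ∣ length is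
  paired _ [] _ _ _ = 2 ∣0
  paired (suc (suc m)) (i ∷ is) len uniq@(i∉is ∷ _) closed with closed (here ≡.refl)
  ... | here fi≡i    = ⊥-elim (free i fi≡i)
  ... | there fi∈is with extract fi∈is
  ...   | _ , js , is↭ , ≡.refl with ↭ₛ-unique is↭ uniq
    where
    ↭ₛ-unique : ∀ {is js k i} → is ↭ k ∷ js → Unique (i ∷ is) → Unique (i ∷ k ∷ js)
    ↭ₛ-unique p = ↭ₛ.Unique-resp-↭ (≡.setoid _) (↭⇒↭ₛ (prep _ p))
  ...     | (i≢fi ∷ i∉js) ∷ fi∉js ∷ ujs =
    ≡.subst (2 ∣_) (≡.cong suc (≡.sym (↭-length is↭)))
      (∣m∣n⇒∣m+n {m = 2} ∣-refl
        (paired m js (suc-injective (≡.trans (≡.sym (↭-length is↭)) (suc-injective len))) ujs closed′))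
    where
    closed′ : ∀ {j} → j ∈ js → f j ∈ js
    closed′ {j} j∈js
      with ∈-resp-↭ (prep i is↭) (closed (∈-resp-↭ (↭-sym (prep i is↭)) (there (there j∈js))))
    ... | here fj≡i            = ⊥-elim (All.lookup fi∉js j∈js
      (≡.trans (≡.cong f (≡.sym fj≡i)) (involutive j)))
    ... | there (here fj≡fi)   = ⊥-elim (All.lookup i∉js j∈js
      (≡.trans (≡.sym (involutive i)) (≡.trans (≡.cong f (≡.sym fj≡fi)) (involutive j))))
    ... | there (there fj∈js)  = fj∈js
  paired 1 (i ∷ []) _ _ closed with closed (here ≡.refl)
  ... | here fi≡i = ⊥-elim (free i fi≡i)

module OddOrder {c ℓ} (N : Group c ℓ) (odd : OddSize N) where
  open Group N
  open GroupProperties N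

  private
    module F = Inverse (proj₂ (proj₂ odd))

  from∘to : ∀ x → F.from (F.to x) ≈ x
  from∘to x = F.inverseʳ ≡.refl

  to∘from : ∀ i → F.to (F.from i) ≡ i
  to∘from i = F.inverseˡ refl

  _≟_ : Decidable _≈_
  x ≟ y = map′ (λ eq → trans (sym (from∘to x)) (trans (F.from-cong eq) (from∘to y))) F.to-cong
    (F.to x Fin.≟ F.to y)

  -- Left translation by an involution, carried over to `Fin n`, would be an involution without
  -- fixed points, and `n` would be even.
  x²≈ε⇒x≈ε : ∀ {x} → x ∙ x ≈ ε → x ≈ ε
  x²≈ε⇒x≈ε {x} x²≈ε with x ≟ ε
  ... | yes x≈ε = x≈ε
  ... | no  x≉ε with ≡.trans (≡.sym (proj₁ (proj₂ odd)))
                  (n∣m⇒m%n≡0 _ 2 (fixed-point-free⇒even f involutive free))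
    where
    f = λ i → F.to (x ∙ F.from i)

    involutive : ∀ i → f (f i) ≡ i
    involutive i = ≡.trans
      (F.to-cong (trans (∙-congˡ (from∘to _))
        (trans (sym (assoc x x _)) (trans (∙-congʳ x²≈ε) (identityˡ _)))))
      (to∘from i)

    free : ∀ i → f i ≢ i
    free i fi≡i = x≉ε (identityˡ-unique x (F.from i)
      (trans (sym (from∘to _)) (F.from-cong fi≡i)))
  ... | ()

-- The theorem for `k` congruent to 8 modulo 10.

k/2≡4+5⌊k/10⌋ : ∀ k → k % 10 ≡ 8 → k / 2 ≡ 4 + k / 10 * 5
k/2≡4+5⌊k/10⌋ k k%10≡8 = ≡.trans (≡.cong (_/ 2) k≡) (m*n/n≡m (4 + k / 10 * 5) 2)
  where
  k≡ : k ≡ (4 + k / 10 * 5) * 2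
  k≡ = ≡.trans (m≡m%n+[m/n]*n k 10) (≡.trans (≡.cong (_+ k / 10 * 10) k%10≡8)
    (≡.trans (≡.cong (8 +_) (≡.sym (*-assoc (k / 10) 5 2))) (≡.sym (*-distribʳ-+ 2 4 (k / 10 * 5)))))

theorem4p5 : {c ℓ p : Level} (N : Group c ℓ) → OddSize N →
    (φ : Action ℤ₂ N) →
    (k : ℕ) → 0 < k → k % 10 ≡ 8 →
    (S : Pred (Group.Carrier (N ⋊ℤ₂[ φ ])) p) →
    Group.ε (N ⋊ℤ₂[ φ ]) ∉ S →
    HasType N φ S (k / 2) (k / 2) →
    ∃ λ ys → IsWeakSequencing (N ⋊ℤ₂[ φ ]) 4 S ys × AlternatingParity N φ ys
theorem4p5 N odd φ k 0<k k%10≡8 S ε∉S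
  ((es , (unique-es , es⇔) , |es|) , (xs , (unique-xs , xs⇔) , |xs|)) =
  flatten ps ,
  ((Unique-resp-↭ (↭-sym ys↭) unique-es++xs , λ g → mk⇔ (to g) (from g)) ,
   Clean⇒partialSum-≉ (flatten ps) (Valid⇒Clean proper valid)) ,
  flatten-alternates proper
  where
  module φ = GroupHomomorphism φ
  open OddOrder N odd using (x²≈ε⇒x≈ε) renaming (_≟_ to _≟ᴺ_)

  G = N ⋊ℤ₂[ φ ]
  open Group G
  open import Data.List.Membership.Setoid setoid using () renaming (_∈_ to _∈ₛ_)
  open UniqueSetoid setoid using (Unique)

  _≟_ : Decidable _≈_
  (x , a) ≟ (y , b) = (x ≟ᴺ y) ×-dec (a ℙ.≟ b)

  open Pool G _≟_ using (Unique-resp-↭)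
  open Long G _≟_ using (Arrangement; long)
  open Words⇒Sequencings G proj₂ proj₂ ≡.refl (λ _ _ → ≡.refl)

  -- The even part acts through `φ` at the identity, that is trivially, so an even element is
  -- squared within `N`.
  no-involution : ∀ {g} → proj₂ g ≡ 0ℙ → g ∙ g ≈ ε → g ≈ ε
  no-involution {x , _} ≡.refl (xx≈ε , _) =
    x²≈ε⇒x≈ε (Group.trans N (Group.∙-congˡ N (Group.sym N (φ.ε-homo x))) xx≈ε) , ≡.refl

  ordered⇒All : ∀ {q} {Q : Pred Carrier q} {ys} → (∀ g → g ∈ₛ ys ⇔ (S ∩ Q) g) → All (S ∩ Q) ys
  ordered⇒All ys⇔ = All.tabulate λ y∈ → Equivalence.to (ys⇔ _) (Any.map (λ { ≡.refl → refl }) y∈)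

  all-even : All (λ e → proj₂ e ≡ 0ℙ) es
  all-even = All.map proj₂ (ordered⇒All es⇔)

  all-odd : All (λ x → proj₂ x ≡ 1ℙ) xs
  all-odd = All.map proj₂ (ordered⇒All xs⇔)

  ε≉es : All (ε ≉_) es
  ε≉es = All.¬Any⇒All¬ es λ ε∈es → ε∉S (proj₁ (Equivalence.to (es⇔ ε) ε∈es))

  unique-es++xs : Unique (es ++ xs)
  unique-es++xs = AllPairs.++⁺ unique-es unique-xs
    (All.map (λ {e} pe → All.map (λ {x} px e≈x → different {e} {x} pe px (proj₂ e≈x)) all-odd)
             all-even)

  |es|≡ : length es ≡ 4 + k / 10 * 5
  |es|≡ = ≡.trans |es| (k/2≡4+5⌊k/10⌋ k k%10≡8)

  |xs|≡ : length xs ≡ 4 + k / 10 * 5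
  |xs|≡ = ≡.trans |xs| (k/2≡4+5⌊k/10⌋ k k%10≡8)

  arrange : ∀ q → length es ≡ 4 + q * 5 → length xs ≡ 4 + q * 5 → Arrangement es xs
  arrange zero |es|≡4 |xs|≡4 = Short.short G _≟_ (λ g → proj₂ g ≡ 0ℙ) ≡.refl
    (λ { ≡.refl ≡.refl → ≡.refl }) (λ pe → pe) no-involution es xs
    (ε≉es ∷ unique-es) unique-xs all-even |es|≡4 |xs|≡4
  -- The `5 (q + 1)` letters beyond four are split as `n + 5` with `n = 5 q`; the case of `zero`
  -- above is `k = 8`.
  arrange (suc q) |es|≡ |xs|≡ = long (q * 5) unique-es unique-xs
    (≡.trans |es|≡ (≡.cong (4 +_) (+-comm 5 (q * 5)))) (≡.trans |xs|≡ (≡.cong (4 +_) (+-comm 5 (q * 5))))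
    (All.map (λ pe → no-involution pe) all-even)

  arrangement : Arrangement es xs
  arrangement = arrange (k / 10) |es|≡ |xs|≡

  ps = proj₁ arrangement
  valid = proj₁ (proj₂ arrangement)
  ps₁↭es = proj₁ (proj₂ (proj₂ arrangement))
  ps₂↭xs = proj₂ (proj₂ (proj₂ arrangement))

  proper : All Proper ps
  proper = All.zipWith (λ ((e≉ε , pe) , px) → e≉ε , pe , px)
    ( All.zip ( All.map⁻ (All-resp-↭ (↭-sym ps₁↭es) (All.map (λ ε≉e → ε≉e ∘ sym) ε≉es))
              , All.map⁻ (All-resp-↭ (↭-sym ps₁↭es) all-even))
    , All.map⁻ (All-resp-↭ (↭-sym ps₂↭xs) all-odd))

  ys↭ : flatten ps ↭ es ++ xs
  ys↭ = ↭-trans (flatten-↭ ps) (++⁺ ps₁↭es ps₂↭xs)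

  to : ∀ g → g ∈ₛ flatten ps → S g
  to g g∈ with Any.++⁻ es (Any-resp-↭ ys↭ g∈)
  ... | inj₁ g∈es = proj₁ (Equivalence.to (es⇔ g) g∈es)
  ... | inj₂ g∈xs = proj₁ (Equivalence.to (xs⇔ g) g∈xs)

  from : ∀ g → S g → g ∈ₛ flatten ps
  from g@(_ , 0ℙ) Sg = Any-resp-↭ (↭-sym ys↭) (Any.++⁺ˡ (Equivalence.from (es⇔ g) (Sg , ≡.refl)))
  from g@(_ , 1ℙ) Sg = Any-resp-↭ (↭-sym ys↭) (Any.++⁺ʳ es (Equivalence.from (xs⇔ g) (Sg , ≡.refl)))
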